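{- For any signature $\Sigma$, the quadruple consisting of the class of $\Sigma$-forest-like alphabets, the disjoint sum operation $\mathbin{+\!\!+}$, the maps $r_A$, and the alphabet $A_p(\Sigma)$ is a polynomial realization of the Hopf algebra $\mathbf N(T(\Sigma))$. That is: (i) $\mathbin{+\!\!+}$ is associative; (ii) for every $\Sigma$-forest-like alphabet $A$, $r_A:\mathbf N(T(\Sigma))\to\mathbb K\langle A\rangle$ is a graded unital associative algebra morphism; (iii) for all $\Sigma$-forest-like alphabets $A_1,A_2$ and every $x\in\mathbf N(T(\Sigma))$, $\theta_{A_1,A_2}(r_{A_1\mathbin{+\!\!+}A_2}(x))=(r_{A_1}\otimes r_{A_2})(\Delta x)$; (iv) $r_{A_p(\Sigma)}$ is injective.
   Context: $\mathbb K$ is a field of characteristic zero; $[P]$ is $1$ if $P$ holds, $0$ otherwise. A signature is a set $\Sigma$ with arity map $|\cdot|:\Sigma\to\mathbb N$. A $\Sigma$-term is the leaf $\bot$ or $s(t_1,\dots,t_n)$ with $s$ of arity $n$, $t_i$ terms; degree = number of internal nodes, arity $|t|$ = number of leaves. $T(\Sigma)$ is the free operad: $t[t_1,\dots,t_{|t|}]$ grafts $t_i$ on the $i$-th leaf of $t$. A $\Sigma$-forest is a finite word of terms; reduced if no term is $\bot$; $\mathrm{rd}$ deletes terms equal to $\bot$. Internal nodes of a forest $f$ are identified with $1,\dots,\deg f$ by preorder; $d_f(i)$ decoration of $i$; $i\to^f_j i'$ means $i'$ is the $j$-th child of $i$; roots are the roots of terms. $\mathbf N(T(\Sigma))$: basis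 $E_f$ ($f$ reduced), product $E_{f_1}E_{f_2}=E_{f_1f_2}$, grading $\deg f$, coproduct the algebra morphism with $\Delta E_t=\sum E_{\mathrm{rd}(t')}\otimes E_{\mathrm{rd}(t_1\cdots t_{|t'|})}$ over all $t',t_1,\dots$ with $t=t'[t_1,\dots,t_{|t'|}]$. A $\Sigma$-forest-like alphabet is a set $A$ with arbitrary: subset $R^A$, subsets $D^A_s$ ($s\in\Sigma$), binary relations $\to^A_j$ ($j\ge1$). $\mathbb K\langle A\rangle$: noncommutative polynomials over $A$ with possibly infinite support and bounded degree. A word $w\in A^*$ is $A$-compatible with $f$ if it has length $\deg f$, $w(i)\in R^A$ for each root $i$, $w(i)\in D^A_{d_f(i)}$ for each $i$, and $i\to^f_j i'$ implies $w(i)\to^A_j w(i')$. $r_A(E_f)=\sum_{w\in A^*}[w\ A\text{ -compatible with }f]\,w$. The disjoint sum $A_1\mathbin{+\!\!+}A_2$ is $A_1\sqcup A_2$ with $R=R^{A_1}\sqcup R^{A_2}$, $D_s=D^{A_1}_s\sqcup D^{A_2}_s$, and $a\to_j a'$ iff ($a,a'\in A_1$, $a\to^{A_1}_j a'$) or ($a,a'\in A_2$, $a\to^{A_2}_j a'$) or ($a\in A_1$, $a'\in A_2$, $a'\in R^{A_2}$). $\theta_{A_1,A_2}$ is the linear map $w\mapsto w_{|A_1}\otimes w_{|A_2}$. The alphabet of positions $A_p(\Sigma)=\{a^s_u:s\in\Sigma,u\in\mathbb N^*\}$ has root relation $\{a^s_{0^\ell}\}$, $D_s=\{a^s_u:u\in\mathbb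 N^*\}$, and $a^s_u\to_j a^{s'}_v$ iff $v=u\,j\,0^\ell$ for some $\ell\in\mathbb N$. -}

module Defs where

open import Algebra.Bundles using (CommutativeRing)
open import Algebra.Bundles.Raw using (RawRing)
open import Algebra.Definitions.RawMonoid using () renaming (_×_ to multiple)
open import Algebra.Module.Bundles.Raw using (RawLeftModule)
open import Algebra.Module.Morphism.Structures using (module LeftModuleMorphisms)
open import Algebra.Morphism.Structures using (module RingMorphisms)
open import Axiom.ExcludedMiddle using (ExcludedMiddle)
open import Data.Bool.Base using (if_then_else_)
open import Data.Empty.Polymorphic using (⊥)
open import Data.Fin.Base using (Fin; zero; suc; toℕ; splitAt; _↑ˡ_; _↑ʳ_; cast)
open import Data.List.Base using (List; []; _∷_; _++_; map; foldr; filter; length; lookup; replicate; partitionSums; cartesianProductWith)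
open import Data.List.Membership.Propositional using (_∈_)
open import Data.List.Membership.Propositional.Properties using (∈-map⁺; ∈-map⁻; ∈-++⁺ˡ; ∈-++⁺ʳ; ∈-++⁻; ∈-cartesianProductWith⁺; ∈-cartesianProductWith⁻)
open import Data.List.Properties using (length-++; ∷-injectiveʳ)
open import Data.List.Relation.Unary.All using (All; []; _∷_; tabulate)
open import Data.List.Relation.Unary.All.Properties using (all-filter) renaming (++⁺ to All-++⁺)
open import Data.List.Relation.Unary.AllPairs using ([]; _∷_)
open import Data.List.Relation.Unary.Any using (here; there)
open import Data.List.Relation.Unary.Unique.Propositional using (Unique)
open import Data.List.Relation.Unary.Unique.Propositional.Properties using () renaming (map⁺ to Unique-map⁺; ++⁺ to Unique-++⁺; cartesianProductWith⁺ to Unique-cartesianProductWith⁺)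
open import Data.Nat.Base as ℕ using (ℕ; zero; suc; NonZero; _<_; _⊔_)
open import Data.Nat.Properties using (≤-trans; m≤m⊔n; m≤n⊔m; <⇒≢; ≮⇒≥; +-mono-≤; <⇒≱; _<?_)
open import Data.Product.Base using (Σ; ∃; ∃₂; ∃-syntax; _×_; _,_; proj₁; proj₂; map₁)
open import Data.Product.Properties using (,-injectiveˡ)
open import Data.Sum.Base using (_⊎_; inj₁; inj₂; [_,_]′)
open import Data.Vec.Base as Vec using (Vec; []; _∷_)
open import Data.Vec.Properties using (take++drop≡id; ++-injective)
open import Function.Base using (_∘_; case_of_)
open import Function.Bundles using (_⇔_)
open import Function.Definitions using (Bijective)
open import Level using () renaming (_⊔_ to _⊔ˡ_; suc to sucˡ)
open import Relation.Binary.Core using (Rel)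
open import Relation.Binary.PropositionalEquality using (_≡_; _≢_; refl; sym; trans; cong; cong₂; subst)
open import Relation.Nullary using (¬_; Dec; yes; no; does; contradiction)
open import Relation.Unary using (Pred)

record IsField {c k} (K : CommutativeRing c k) : Set (c ⊔ˡ k) where
  open CommutativeRing K
  field
    1≉0     : ¬ (1# ≈ 0#)
    inverse : ∀ x → ¬ (x ≈ 0#) → ∃[ y ] x * y ≈ 1#

CharacteristicZero : ∀ {c k} → CommutativeRing c k → Set k
CharacteristicZero K = ∀ n → multiple +-rawMonoid n 1# ≈ 0# → n ≡ 0
  where open CommutativeRing K

-- Every sum over "all x such that P x" below runs
-- over an Enumeration of P, so its range is pinned down by the type.

record Enumeration {a p} {X : Set a} (P : Pred X p) : Set (a ⊔ˡ p) where
  field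
    elements : List X
    unique   : Unique elements
    sound    : ∀ {x} → x ∈ elements → P x
    complete : ∀ {x} → P x → x ∈ elements

open Enumeration

module _ {a} {A : Set a} where

  module Factorizations where
    go : List A → List (List A × List A)
    go []      = ([] , []) ∷ []
    go (a ∷ w) = ([] , a ∷ w) ∷ map (map₁ (a ∷_)) (go w)

    go-sound : ∀ w {p : List A × List A} → p ∈ go w → proj₁ p ++ proj₂ p ≡ w
    go-sound []      (here refl) = refl
    go-sound (a ∷ w) (here refl) = refl
    go-sound (a ∷ w) (there p∈) with ∈-map⁻ (map₁ (a ∷_)) p∈
    ... | _ , q∈ , refl = cong (a ∷_) (go-sound w q∈)

    go-complete : ∀ w u v → u ++ v ≡ w → (u , v) ∈ go w
    go-complete []      []      v refl = here refl
    go-complete (a ∷ w) []      v refl = here refl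
    go-complete (a ∷ w) (_ ∷ u) v refl = there (∈-map⁺ (map₁ (a ∷_)) (go-complete w u v refl))

    go-unique : ∀ w → Unique (go w)
    go-unique []      = [] ∷ []
    go-unique (a ∷ w) =
      tabulate (λ p∈ eq → case ∈-map⁻ (map₁ (a ∷_)) p∈ of λ { (_ , _ , eq′) → case trans eq eq′ of λ () })
      ∷ Unique-map⁺ (λ { refl → refl }) (go-unique w)

  factorizations : (w : List A) → Enumeration {X = List A × List A} (λ (u , v) → u ++ v ≡ w)
  factorizations w = record
    { elements = Factorizations.go w
    ; unique   = Factorizations.go-unique w
    ; sound    = Factorizations.go-sound w
    ; complete = λ {(u , v)} → Factorizations.go-complete w u v
    }

-- For w over the alphabet A ⊎ B, partitionSums w is the pair (w|A , w|B).

module _ {a b} {A : Set a} {B : Set b} where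

  module Shuffles where
    go : List A → List B → List (List (A ⊎ B))
    go []      []      = [] ∷ []
    go []      (b ∷ v) = map (inj₂ b ∷_) (go [] v)
    go (a ∷ u) []      = map (inj₁ a ∷_) (go u [])
    go (a ∷ u) (b ∷ v) = map (inj₁ a ∷_) (go u (b ∷ v)) ++ map (inj₂ b ∷_) (go (a ∷ u) v)

    consˡ : ∀ {a : A} {w : List (A ⊎ B)} {u v} → partitionSums w ≡ (u , v) → partitionSums (inj₁ a ∷ w) ≡ (a ∷ u , v)
    consˡ eq rewrite eq = refl

    consʳ : ∀ {b : B} {w : List (A ⊎ B)} {u v} → partitionSums w ≡ (u , v) → partitionSums (inj₂ b ∷ w) ≡ (u , b ∷ v)
    consʳ eq rewrite eq = refl

    go-sound : ∀ u v {w} → w ∈ go u v → partitionSums w ≡ (u , v)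
    go-sound []      []      (here refl) = refl
    go-sound []      (b ∷ v) w∈ with ∈-map⁻ (inj₂ b ∷_) w∈
    ... | w′ , w′∈ , refl = consʳ {w = w′} (go-sound [] v w′∈)
    go-sound (a ∷ u) []      w∈ with ∈-map⁻ (inj₁ a ∷_) w∈
    ... | w′ , w′∈ , refl = consˡ {w = w′} (go-sound u [] w′∈)
    go-sound (a ∷ u) (b ∷ v) w∈ with ∈-++⁻ (map (inj₁ a ∷_) (go u (b ∷ v))) w∈
    ... | inj₁ l with ∈-map⁻ (inj₁ a ∷_) l
    ...   | w′ , w′∈ , refl = consˡ {w = w′} (go-sound u (b ∷ v) w′∈)
    go-sound (a ∷ u) (b ∷ v) w∈ | inj₂ r with ∈-map⁻ (inj₂ b ∷_) r
    ...   | w′ , w′∈ , refl = consʳ {w = w′} (go-sound (a ∷ u) v w′∈)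

    goˡ : ∀ a u v {w} → w ∈ go u v → (inj₁ a ∷ w) ∈ go (a ∷ u) v
    goˡ a u []      w∈ = ∈-map⁺ (inj₁ a ∷_) w∈
    goˡ a u (b ∷ v) w∈ = ∈-++⁺ˡ (∈-map⁺ (inj₁ a ∷_) w∈)

    goʳ : ∀ b u v {w} → w ∈ go u v → (inj₂ b ∷ w) ∈ go u (b ∷ v)
    goʳ b []      v w∈ = ∈-map⁺ (inj₂ b ∷_) w∈
    goʳ b (a ∷ u) v w∈ = ∈-++⁺ʳ (map (inj₁ a ∷_) (go u (b ∷ v))) (∈-map⁺ (inj₂ b ∷_) w∈)

    go-complete : ∀ w u v → partitionSums w ≡ (u , v) → w ∈ go u v
    go-complete []           u v refl = here refl
    go-complete (inj₁ a ∷ w) u v refl = goˡ a (proj₁ (partitionSums w)) (proj₂ (partitionSums w)) (go-complete w _ _ refl)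
    go-complete (inj₂ b ∷ w) u v refl = goʳ b (proj₁ (partitionSums w)) (proj₂ (partitionSums w)) (go-complete w _ _ refl)

    go-unique : ∀ u v → Unique (go u v)
    go-unique []      []      = [] ∷ []
    go-unique []      (b ∷ v) = Unique-map⁺ ∷-injectiveʳ (go-unique [] v)
    go-unique (a ∷ u) []      = Unique-map⁺ ∷-injectiveʳ (go-unique u [])
    go-unique (a ∷ u) (b ∷ v) = Unique-++⁺
      (Unique-map⁺ ∷-injectiveʳ (go-unique u (b ∷ v)))
      (Unique-map⁺ ∷-injectiveʳ (go-unique (a ∷ u) v))
      λ (l , r) → case ∈-map⁻ (inj₁ a ∷_) l of λ { (_ , _ , refl) →
                  case ∈-map⁻ (inj₂ b ∷_) r of λ { (_ , _ , ()) } }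

  shuffles : (u : List A) (v : List B) → Enumeration {X = List (A ⊎ B)} (λ w → partitionSums w ≡ (u , v))
  shuffles u v = record
    { elements = Shuffles.go u v
    ; unique   = Shuffles.go-unique u v
    ; sound    = Shuffles.go-sound u v
    ; complete = λ {w} → Shuffles.go-complete w u v
    }

record Signature ℓ : Set (sucˡ ℓ) where
  field
    Symbol : Set ℓ
    arity  : Symbol → ℕ

module Forests {ℓ} (𝒮 : Signature ℓ) where
  open Signature 𝒮

  data Term : Set ℓ where
    leaf : Term
    node : (s : Symbol) → Vec Term (arity s) → Term

  mutual
    degree : Term → ℕ
    degree leaf        = 0
    degree (node s ts) = suc (degrees ts)

    degrees : ∀ {n} → Vec Term n → ℕ
    degrees []       = 0
    degrees (t ∷ ts) = degree t ℕ.+ degrees ts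

  mutual
    ∣_∣ : Term → ℕ
    ∣ leaf ∣      = 1
    ∣ node s ts ∣ = ∣ ts ∣*

    ∣_∣* : ∀ {n} → Vec Term n → ℕ
    ∣ [] ∣*     = 0
    ∣ t ∷ ts ∣* = ∣ t ∣ ℕ.+ ∣ ts ∣*

  mutual
    _[_] : (t : Term) → Vec Term ∣ t ∣ → Term
    leaf      [ u ∷ [] ] = u
    node s ts [ us ]     = node s (ts [ us ]*)

    _[_]* : ∀ {n} (ts : Vec Term n) → Vec Term ∣ ts ∣* → Vec Term n
    []       [ us ]* = []
    (t ∷ ts) [ us ]* = t [ Vec.take ∣ t ∣ us ] ∷ ts [ Vec.drop ∣ t ∣ us ]*

  Decomposition : Set ℓ
  Decomposition = Σ Term λ t′ → Vec Term ∣ t′ ∣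

  module Decompositions where
    Decomposition* : ℕ → Set ℓ
    Decomposition* n = Σ (Vec Term n) λ ts′ → Vec Term ∣ ts′ ∣*

    node′ : ∀ s → Decomposition* (arity s) → Decomposition
    node′ s (ts′ , us) = node s ts′ , us

    cons : ∀ {n} → Decomposition → Decomposition* n → Decomposition* (suc n)
    cons (t′ , us) (ts′ , vs) = t′ ∷ ts′ , us Vec.++ vs

    mutual
      go : Term → List Decomposition
      go leaf        = (leaf , leaf ∷ []) ∷ []
      go (node s ts) = (leaf , node s ts ∷ []) ∷ map (node′ s) (go* ts)

      go* : ∀ {n} → Vec Term n → List (Decomposition* n)
      go* []       = ([] , []) ∷ []
      go* (t ∷ ts) = cartesianProductWith cons (go t) (go* ts)

    take-++ : ∀ {m n} (us : Vec Term m) (vs : Vec Term n) → Vec.take m (us Vec.++ vs) ≡ us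
    take-++ {m} us vs = proj₁ (++-injective _ us (take++drop≡id m (us Vec.++ vs)))

    drop-++ : ∀ {m n} (us : Vec Term m) (vs : Vec Term n) → Vec.drop m (us Vec.++ vs) ≡ vs
    drop-++ {m} us vs = proj₂ (++-injective (Vec.take m (us Vec.++ vs)) us (take++drop≡id m (us Vec.++ vs)))

    mutual
      go-sound : ∀ t {d} → d ∈ go t → proj₁ d [ proj₂ d ] ≡ t
      go-sound leaf        (here refl) = refl
      go-sound (node s ts) (here refl) = refl
      go-sound (node s ts) (there d∈) with ∈-map⁻ (node′ s) d∈
      ... | _ , e∈ , refl = cong (node s) (go*-sound ts e∈)

      go*-sound : ∀ {n} (ts : Vec Term n) {d} → d ∈ go* ts → proj₁ d [ proj₂ d ]* ≡ ts
      go*-sound []       (here refl) = refl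
      go*-sound (t ∷ ts) d∈ with ∈-cartesianProductWith⁻ cons (go t) (go* ts) d∈
      ... | (t′ , us) , (ts′ , vs) , l , r , refl = cong₂ _∷_
        (trans (cong (t′ [_]) (take-++ us vs)) (go-sound t l))
        (trans (cong (ts′ [_]*) (drop-++ us vs)) (go*-sound ts r))

    mutual
      go-complete : ∀ t′ us → (t′ , us) ∈ go (t′ [ us ])
      go-complete leaf        (leaf ∷ [])      = here refl
      go-complete leaf        (node s ts ∷ []) = here refl
      go-complete (node s ts) us               = there (∈-map⁺ (node′ s) (go*-complete ts us))

      go*-complete : ∀ {n} (ts′ : Vec Term n) us → (ts′ , us) ∈ go* (ts′ [ us ]*)
      go*-complete []         []  = here refl
      go*-complete (t′ ∷ ts′) us = subst
        (λ vs → (t′ ∷ ts′ , vs) ∈ go* ((t′ ∷ ts′) [ us ]*))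
        (take++drop≡id ∣ t′ ∣ us)
        (∈-cartesianProductWith⁺ cons
          (go-complete t′ (Vec.take ∣ t′ ∣ us)) (go*-complete ts′ (Vec.drop ∣ t′ ∣ us)))

    vec-injective : ∀ {n} {ts : Vec Term n} {us vs : Vec Term ∣ ts ∣*} →
                    _≡_ {A = Decomposition* n} (ts , us) (ts , vs) → us ≡ vs
    vec-injective refl = refl

    cons-injective : ∀ {n} {d d′ : Decomposition} {e e′ : Decomposition* n} →
                     cons d e ≡ cons d′ e′ → d ≡ d′ × e ≡ e′
    cons-injective {d = t , us} {t′ , us′} {ts , vs} {ts′ , vs′} eq with ,-injectiveˡ eq
    ... | refl with ++-injective us us′ (vec-injective eq)
    ...   | refl , refl = refl , refl

    mutual
      go-unique : ∀ t → Unique (go t)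
      go-unique leaf        = [] ∷ []
      go-unique (node s ts) =
        tabulate (λ d∈ eq → case ∈-map⁻ (node′ s) d∈ of λ { (_ , _ , eq′) → case trans eq eq′ of λ () })
        ∷ Unique-map⁺ (λ { refl → refl }) (go*-unique ts)

      go*-unique : ∀ {n} (ts : Vec Term n) → Unique (go* ts)
      go*-unique []       = [] ∷ []
      go*-unique (t ∷ ts) = Unique-cartesianProductWith⁺ cons cons-injective (go-unique t) (go*-unique ts)

  decompositions : (t : Term) → Enumeration {X = Decomposition} (λ (t′ , us) → t′ [ us ] ≡ t)
  decompositions t = record
    { elements = Decompositions.go t
    ; unique   = Decompositions.go-unique t
    ; sound    = Decompositions.go-sound t
    ; complete = λ {(t′ , us)} eq →
        subst (λ t → (t′ , us) ∈ Decompositions.go t) eq (Decompositions.go-complete t′ us)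
    }

  Forest : Set ℓ
  Forest = List Term

  Reduced : Pred Forest ℓ
  Reduced = All (_≢ leaf)

  record ReducedForest : Set ℓ where
    constructor _,_
    field
      forest   : Forest
      .reduced : Reduced forest

  open ReducedForest public

  nonLeaf? : ∀ t → Dec (t ≢ leaf)
  nonLeaf? leaf       = no λ t≢leaf → t≢leaf refl
  nonLeaf? (node _ _) = yes λ ()

  rd : Forest → ReducedForest
  rd f = filter nonLeaf? f , all-filter nonLeaf? f

  ∅ : ReducedForest
  ∅ = [] , []

  _·_ : ReducedForest → ReducedForest → ReducedForest
  (f , f-red) · (g , g-red) = f ++ g , All-++⁺ f-red g-red

  deg : Forest → ℕ
  deg f = degrees (Vec.fromList f)

  -- Internal nodes are numbered from 0 in preorder: the root of a term
  -- comes first, and the nodes of t ∷ ts are those of t followed by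
  -- those of ts.

  mutual
    decoration : (t : Term) → Fin (degree t) → Symbol
    decoration (node s ts) zero    = s
    decoration (node s ts) (suc i) = decorations ts i

    decorations : ∀ {n} (ts : Vec Term n) → Fin (degrees ts) → Symbol
    decorations (t ∷ ts) i = [ decoration t , decorations ts ]′ (splitAt (degree t) i)

  -- RootOf ts j i: the j-th term of ts (from 0) is not a leaf and its root is i.

  data RootOf : ∀ {n} (ts : Vec Term n) → Fin n → Fin (degrees ts) → Set ℓ where
    here  : ∀ {n s us} {ts : Vec Term n} → RootOf (node s us ∷ ts) zero zero
    there : ∀ {n t} {ts : Vec Term n} {j i} → RootOf ts j i → RootOf (t ∷ ts) (suc j) (degree t ↑ʳ i)

  -- Child t j i i′: the node i′ is the j-th child (from 1) of i.

  mutual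
    data Child : (t : Term) (j : ℕ) (i i′ : Fin (degree t)) → Set ℓ where
      top   : ∀ {s ts j i} → RootOf ts j i → Child (node s ts) (suc (toℕ j)) zero (suc i)
      below : ∀ {s ts j i i′} → Child* ts j i i′ → Child (node s ts) j (suc i) (suc i′)

    data Child* : ∀ {n} (ts : Vec Term n) (j : ℕ) (i i′ : Fin (degrees ts)) → Set ℓ where
      here  : ∀ {n t} {ts : Vec Term n} {j i i′} → Child t j i i′ →
              Child* (t ∷ ts) j (i ↑ˡ degrees ts) (i′ ↑ˡ degrees ts)
      there : ∀ {n t} {ts : Vec Term n} {j i i′} → Child* ts j i i′ →
              Child* (t ∷ ts) j (degree t ↑ʳ i) (degree t ↑ʳ i′)

  d : (f : Forest) → Fin (deg f) → Symbol
  d f = decorations (Vec.fromList f)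

  IsRoot : (f : Forest) → Fin (deg f) → Set ℓ
  IsRoot f i = ∃[ j ] RootOf (Vec.fromList f) j i

  IsChild : (f : Forest) (j : ℕ) → Rel (Fin (deg f)) ℓ
  IsChild f = Child* (Vec.fromList f)

record Alphabet {ℓ} (𝒮 : Signature ℓ) : Set (sucˡ ℓ) where
  open Signature 𝒮
  field
    Letter : Set ℓ
    R      : Pred Letter ℓ
    D      : Symbol → Pred Letter ℓ
    E      : (j : ℕ) .{{_ : NonZero j}} → Rel Letter ℓ

open Alphabet

module _ {ℓ} {𝒮 : Signature ℓ} where
  open Signature 𝒮
  open Forests 𝒮

  record Compatible (A : Alphabet 𝒮) (f : Forest) (w : List (Letter A)) : Set ℓ where
    field
      length-≡ : length w ≡ deg f

    letter : Fin (deg f) → Letter A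
    letter i = lookup w (cast (sym length-≡) i)

    field
      root-∈R  : ∀ i → IsRoot f i → R A (letter i)
      node-∈D  : ∀ i → D A (d f i) (letter i)
      child-∈E : ∀ j .{{_ : NonZero j}} i i′ → IsChild f j i i′ → E A j (letter i) (letter i′)

  infixr 5 _⧺_

  _⧺_ : Alphabet 𝒮 → Alphabet 𝒮 → Alphabet 𝒮
  A₁ ⧺ A₂ = record
    { Letter = Letter A₁ ⊎ Letter A₂
    ; R      = [ R A₁ , R A₂ ]′
    ; D      = λ s → [ D A₁ s , D A₂ s ]′
    ; E      = edge
    }
    where
    edge : (j : ℕ) .{{_ : NonZero j}} → Rel (Letter A₁ ⊎ Letter A₂) ℓ
    edge j (inj₁ a) (inj₁ a′) = E A₁ j a a′
    edge j (inj₂ a) (inj₂ a′) = E A₂ j a a′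
    edge j (inj₁ a) (inj₂ a′) = R A₂ a′
    edge j (inj₂ a) (inj₁ a′) = ⊥

  record IsIsomorphism (A B : Alphabet 𝒮) (φ : Letter A → Letter B) : Set ℓ where
    field
      bijective : Bijective _≡_ _≡_ φ
      R-⇔       : ∀ a → R A a ⇔ R B (φ a)
      D-⇔       : ∀ s a → D A s a ⇔ D B s (φ a)
      E-⇔       : ∀ j .{{_ : NonZero j}} a a′ → E A j a a′ ⇔ E B j (φ a) (φ a′)

-- The letter aˢᵤ is the pair (s , u).

positions : ∀ {ℓ} (𝒮 : Signature ℓ) → Alphabet 𝒮
positions 𝒮 = record
  { Letter = Symbol × List ℕ
  ; R      = λ a → ∃₂ λ s l → a ≡ (s , replicate l 0)
  ; D      = λ s a → ∃ λ u → a ≡ (s , u)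
  ; E      = λ j a a′ → ∃₂ λ s u → ∃₂ λ s′ l →
               a ≡ (s , u) × a′ ≡ (s′ , u ++ j ∷ replicate l 0)
  }
  where open Signature 𝒮

-- Excluded middle at level ℓ is what turns an arbitrary predicate P into
-- the coefficient [P]; it plays no other role in the definitions.

module Realization {c k ℓ} (em : ExcludedMiddle ℓ) (K : CommutativeRing c k) (𝒮 : Signature ℓ) where
  open CommutativeRing K using (_≈_; _+_; _*_; -_; 0#; 1#; zeroˡ; zeroʳ; +-cong; *-cong; +-identityˡ; -‿cong)
    renaming (Carrier to 𝕂; refl to ≈-refl; trans to ≈-trans; reflexive to ≈-reflexive)
  open import Algebra.Properties.Ring (CommutativeRing.ring K) using (-0#≈0#)
  open Forests 𝒮

  𝟙[_] : Set ℓ → 𝕂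
  𝟙[ P ] = if does (em {P}) then 1# else 0#

  ∑ : ∀ {a} {X : Set a} → List X → (X → 𝕂) → 𝕂
  ∑ xs g = foldr (λ x s → g x + s) 0# xs

  ∑-zero : ∀ {a} {X : Set a} {g : X → 𝕂} xs → (∀ {x} → x ∈ xs → g x ≈ 0#) → ∑ xs g ≈ 0#
  ∑-zero []       g≈0 = ≈-refl
  ∑-zero (x ∷ xs) g≈0 = ≈-trans (+-cong (g≈0 (here refl)) (∑-zero xs (g≈0 ∘ there))) (+-identityˡ 0#)

  -- The 𝕂-vector space with basis B: formal linear combinations, equal
  -- when all their coefficients are.

  Combination : Set ℓ → Set (c ⊔ˡ ℓ)
  Combination B = List (𝕂 × B)

  coefficient : {B : Set ℓ} → Combination B → B → 𝕂
  coefficient x b = ∑ x λ (μ , b′) → μ * 𝟙[ b ≡ b′ ]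

  Free : Set ℓ → RawLeftModule 𝕂 (c ⊔ˡ ℓ) (k ⊔ˡ ℓ)
  Free B = record
    { Carrierᴹ = Combination B
    ; _≈ᴹ_     = λ x y → ∀ b → coefficient x b ≈ coefficient y b
    ; _+ᴹ_     = _++_
    ; _*ₗ_     = λ μ → map (map₁ (μ *_))
    ; 0ᴹ       = []
    ; -ᴹ_      = map (map₁ (-_))
    }

  basis : {B : Set ℓ} → B → Combination B
  basis b = (1# , b) ∷ []

  linear : ∀ {B : Set ℓ} {m n} (M : RawLeftModule 𝕂 m n) →
           (B → RawLeftModule.Carrierᴹ M) → Combination B → RawLeftModule.Carrierᴹ M
  linear M g = foldr (λ (μ , b) y → (μ *ₗ g b) +ᴹ y) 0ᴹ
    where open RawLeftModule M

  bilinear : {B : Set ℓ} → (B → B → B) → Combination B → Combination B → Combination B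
  bilinear _∙_ = cartesianProductWith λ (μ , b) (ν , b′) → μ * ν , b ∙ b′

  N-module : RawLeftModule 𝕂 (c ⊔ˡ ℓ) (k ⊔ˡ ℓ)
  N-module = Free ReducedForest

  open RawLeftModule N-module public using () renaming (Carrierᴹ to N; _≈ᴹ_ to _≈ᴺ_)

  𝐄 : ReducedForest → N
  𝐄 = basis

  N-ring : RawRing (c ⊔ˡ ℓ) (k ⊔ˡ ℓ)
  N-ring = record
    { _≈_ = _≈ᴺ_
    ; _+_ = _+ᴹ_
    ; _*_ = bilinear _·_
    ; -_  = -ᴹ_
    ; 0#  = 0ᴹ
    ; 1#  = 𝐄 ∅
    }
    where open RawLeftModule N-module

  Homogeneousᴺ : ℕ → N → Set (k ⊔ˡ ℓ)
  Homogeneousᴺ n x = ∀ f → deg (forest f) ≢ n → coefficient x f ≈ 0#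

  -- N ⊗ N has the basis 𝐄 f ⊗ 𝐄 g, indexed by pairs (f , g).

  N⊗N-module : RawLeftModule 𝕂 (c ⊔ˡ ℓ) (k ⊔ˡ ℓ)
  N⊗N-module = Free (ReducedForest × ReducedForest)

  open RawLeftModule N⊗N-module public using () renaming (Carrierᴹ to N⊗N)

  _*⊗_ : N⊗N → N⊗N → N⊗N
  _*⊗_ = bilinear λ (f , g) (f′ , g′) → f · f′ , g · g′

  Δ-term : Term → N⊗N
  Δ-term t = map (λ (t′ , us) → 1# , rd (t′ ∷ []) , rd (Vec.toList us)) (elements (decompositions t))

  Δ-forest : Forest → N⊗N
  Δ-forest = foldr (λ t x → Δ-term t *⊗ x) (basis (∅ , ∅))

  Δ : N → N⊗N
  Δ = linear N⊗N-module (Δ-forest ∘ forest)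

  record 𝕂⟨_⟩ (X : Set ℓ) : Set (c ⊔ˡ k ⊔ˡ ℓ) where
    field
      coeff   : List X → 𝕂
      bounded : ∃[ n ] (∀ w → n < length w → coeff w ≈ 0#)

  open 𝕂⟨_⟩ public

  module Polynomials (X : Set ℓ) where

    _≈ᴾ_ : Rel 𝕂⟨ X ⟩ (k ⊔ˡ ℓ)
    P ≈ᴾ Q = ∀ w → coeff P w ≈ coeff Q w

    0ᴾ : 𝕂⟨ X ⟩
    0ᴾ = record { coeff = λ _ → 0# ; bounded = 0 , λ _ _ → ≈-refl }

    1ᴾ : 𝕂⟨ X ⟩
    1ᴾ = record { coeff = one ; bounded = 0 , λ { (_ ∷ _) _ → ≈-refl } }
      where
      one : List X → 𝕂
      one []      = 1#
      one (_ ∷ _) = 0#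

    _+ᴾ_ : 𝕂⟨ X ⟩ → 𝕂⟨ X ⟩ → 𝕂⟨ X ⟩
    P +ᴾ Q = record
      { coeff   = λ w → coeff P w + coeff Q w
      ; bounded = let m , P≈0 = bounded P ; n , Q≈0 = bounded Q in
          m ⊔ n , λ w m⊔n<∣w∣ → ≈-trans
            (+-cong (P≈0 w (≤-trans (ℕ.s≤s (m≤m⊔n m n)) m⊔n<∣w∣)) (Q≈0 w (≤-trans (ℕ.s≤s (m≤n⊔m m n)) m⊔n<∣w∣)))
            (+-identityˡ 0#)
      }

    -ᴾ_ : 𝕂⟨ X ⟩ → 𝕂⟨ X ⟩
    -ᴾ P = record
      { coeff   = λ w → - coeff P w
      ; bounded = let n , P≈0 = bounded P in n , λ w n<∣w∣ → ≈-trans (-‿cong (P≈0 w n<∣w∣)) -0#≈0#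
      }

    _•ᴾ_ : 𝕂 → 𝕂⟨ X ⟩ → 𝕂⟨ X ⟩
    μ •ᴾ P = record
      { coeff   = λ w → μ * coeff P w
      ; bounded = let n , P≈0 = bounded P in n , λ w n<∣w∣ → ≈-trans (*-cong ≈-refl (P≈0 w n<∣w∣)) (zeroʳ μ)
      }

    _*ᴾ_ : 𝕂⟨ X ⟩ → 𝕂⟨ X ⟩ → 𝕂⟨ X ⟩
    P *ᴾ Q = record
      { coeff   = λ w → ∑ (elements (factorizations w)) λ (u , v) → coeff P u * coeff Q v
      ; bounded = m ℕ.+ n , λ w m+n<∣w∣ → ∑-zero (elements (factorizations w)) λ {(u , v)} uv∈ →
          vanishes u v (subst (m ℕ.+ n <_) (trans (cong length (sym (sound (factorizations w) uv∈))) (length-++ u)) m+n<∣w∣)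
      }
      where
      m n : ℕ
      m = proj₁ (bounded P)
      n = proj₁ (bounded Q)

      vanishes : ∀ u v → m ℕ.+ n < length u ℕ.+ length v → coeff P u * coeff Q v ≈ 0#
      vanishes u v lt with m <? length u | n <? length v
      ... | yes m<∣u∣ | _         = ≈-trans (*-cong (proj₂ (bounded P) u m<∣u∣) ≈-refl) (zeroˡ _)
      ... | no _      | yes n<∣v∣ = ≈-trans (*-cong ≈-refl (proj₂ (bounded Q) v n<∣v∣)) (zeroʳ _)
      ... | no m≮∣u∣  | no n≮∣v∣  = contradiction (+-mono-≤ (≮⇒≥ m≮∣u∣) (≮⇒≥ n≮∣v∣)) (<⇒≱ lt)

    rawModule : RawLeftModule 𝕂 (c ⊔ˡ k ⊔ˡ ℓ) (k ⊔ˡ ℓ)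
    rawModule = record
      { _≈ᴹ_ = _≈ᴾ_ ; _+ᴹ_ = _+ᴾ_ ; _*ₗ_ = _•ᴾ_ ; 0ᴹ = 0ᴾ ; -ᴹ_ = -ᴾ_ }

    rawRing : RawRing (c ⊔ˡ k ⊔ˡ ℓ) (k ⊔ˡ ℓ)
    rawRing = record
      { _≈_ = _≈ᴾ_ ; _+_ = _+ᴾ_ ; _*_ = _*ᴾ_ ; -_ = -ᴾ_ ; 0# = 0ᴾ ; 1# = 1ᴾ }

    Homogeneous : ℕ → 𝕂⟨ X ⟩ → Set (k ⊔ˡ ℓ)
    Homogeneous n P = ∀ w → length w ≢ n → coeff P w ≈ 0#

  r-basis : (A : Alphabet 𝒮) → ReducedForest → 𝕂⟨ Letter A ⟩
  r-basis A f = record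
    { coeff   = λ w → 𝟙[ Compatible A (forest f) w ]
    ; bounded = deg (forest f) , λ w deg<∣w∣ → vanishes w (λ eq → <⇒≢ deg<∣w∣ (sym eq))
    }
    where
    vanishes : ∀ w → length w ≢ deg (forest f) → 𝟙[ Compatible A (forest f) w ] ≈ 0#
    vanishes w ≢deg with em {Compatible A (forest f) w}
    ... | yes comp = contradiction (Compatible.length-≡ comp) ≢deg
    ... | no _     = ≈-refl

  r : (A : Alphabet 𝒮) → N → 𝕂⟨ Letter A ⟩
  r A = linear (Polynomials.rawModule (Letter A)) (r-basis A)

  record IsGradedAlgebraMorphism {X : Set ℓ} (φ : N → 𝕂⟨ X ⟩) : Set (c ⊔ˡ k ⊔ˡ ℓ) where
    open Polynomials X
    field
      isLinear           : LeftModuleMorphisms.IsLeftModuleHomomorphism N-module rawModule φ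
      isRingHomomorphism : RingMorphisms.IsRingHomomorphism N-ring rawRing φ
      isGraded           : ∀ n x → Homogeneousᴺ n x → Homogeneous n (φ x)

  -- θ of a polynomial with infinite support need not lie in the
  -- algebraic tensor product 𝕂⟨ X ⟩ ⊗ 𝕂⟨ Y ⟩, so both sides of the
  -- coproduct identity live in the space of all functions X* × Y* → 𝕂, in
  -- which 𝕂⟨ X ⟩ ⊗ 𝕂⟨ Y ⟩ embeds.

  Tensors : (X Y : Set ℓ) → RawLeftModule 𝕂 (c ⊔ˡ ℓ) (k ⊔ˡ ℓ)
  Tensors X Y = record
    { Carrierᴹ = List X → List Y → 𝕂
    ; _≈ᴹ_     = λ S T → ∀ u v → S u v ≈ T u v
    ; _+ᴹ_     = λ S T u v → S u v + T u v
    ; _*ₗ_     = λ μ T u v → μ * T u v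
    ; 0ᴹ       = λ _ _ → 0#
    ; -ᴹ_      = λ T u v → - T u v
    }

  Tensor : (X Y : Set ℓ) → Set (c ⊔ˡ ℓ)
  Tensor X Y = RawLeftModule.Carrierᴹ (Tensors X Y)

  _≈⊗_ : {X Y : Set ℓ} → Rel (Tensor X Y) (k ⊔ˡ ℓ)
  _≈⊗_ {X} {Y} = RawLeftModule._≈ᴹ_ (Tensors X Y)

  _⊗_ : {X Y : Set ℓ} → 𝕂⟨ X ⟩ → 𝕂⟨ Y ⟩ → Tensor X Y
  (P ⊗ Q) u v = coeff P u * coeff Q v

  _⊗₁_ : {X Y : Set ℓ} → (N → 𝕂⟨ X ⟩) → (N → 𝕂⟨ Y ⟩) → N⊗N → Tensor X Y
  _⊗₁_ {X} {Y} φ ψ = linear (Tensors X Y) λ (f , g) → φ (𝐄 f) ⊗ ψ (𝐄 g)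

  -- The coefficient of u ⊗ v in θ P is the sum of the coefficients in P
  -- of all w with w|A₁ = u and w|A₂ = v.

  θ : (A₁ A₂ : Alphabet 𝒮) → 𝕂⟨ Letter (A₁ ⧺ A₂) ⟩ → Tensor (Letter A₁) (Letter A₂)
  θ A₁ A₂ P u v = ∑ (elements (shuffles u v)) (coeff P)

{-# OPTIONS --safe #-}
module Submission where

-- Compatibility of a word with a forest unfolds recursively: the first letter
-- belongs to the first root, and the rest is cut into consecutive words, one per
-- subterm, whose lengths are prescribed. Since the lengths are prescribed, the
-- cutting is unique, which makes r multiplicative.
--
-- For the coproduct, restricting words to A₁ and A₂ is compatible with
-- concatenation, so it suffices to treat a single term t. No edge of A₁ ⧺ A₂
-- leads from A₂ to A₁, hence the nodes of t labelled in A₁ form an upper part t′,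
-- and every root below it is only required to lie in R A₂: the words w on t are
-- in bijection with the decompositions t = t′[t₁, …] equipped with a word on t′
-- and a word on t₁ ⋯.
--
-- For injectivity, label each node of f by its decoration and its path, without any
-- padding zero. The resulting word is compatible with no reduced forest but f,
-- so its coefficient in r x is the coefficient of 𝐄 f in x.

open import Defs
open import Algebra.Bundles using (CommutativeRing)
open import Axiom.ExcludedMiddle using (ExcludedMiddle)
open import Data.Empty.Polymorphic using (⊥)
open import Data.Fin.Base using (Fin; zero; suc; toℕ; splitAt; cast; _↑ˡ_; _↑ʳ_)
open import Data.Fin.Properties using (cast-is-id; splitAt-↑ˡ; splitAt-↑ʳ; splitAt⁻¹-↑ˡ; splitAt⁻¹-↑ʳ)
open import Data.List.Base using (List; []; _∷_; _++_; length; lookup; tabulate; map; concatMap; cartesianProductWith; partitionSums)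
open import Data.List.Membership.Propositional using (_∈_; find; lose)
open import Data.List.Membership.Propositional.Properties using (∈-concatMap⁺; ∈-concatMap⁻; ∈-cartesianProductWith⁺; ∈-cartesianProductWith⁻)
open import Data.List.Membership.Propositional.Properties.WithK using (unique∧set⇒bag)
open import Data.List.Properties using (length-++; ∷-injective; ∷-injectiveˡ; tabulate-cong; length-tabulate; tabulate-lookup; ++-assoc; ++-identityʳ; ++-cancelˡ; map-++)
open import Data.List.Relation.Binary.BagAndSetEquality using (∼bag⇒↭)
open import Data.List.Relation.Binary.Permutation.Propositional using (_↭_; refl; prep; swap) renaming (trans to ↭-trans)
open import Data.List.Relation.Unary.All as All using (All; []; _∷_; all?)
import Data.List.Relation.Unary.All.Properties as All
open import Data.List.Relation.Unary.AllPairs using ([]; _∷_)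
open import Data.List.Relation.Unary.Any using (here; there)
open import Data.List.Relation.Unary.Unique.Propositional using (Unique)
import Data.List.Relation.Unary.Unique.Propositional.Properties as Unique
open import Data.Nat.Base as ℕ using (ℕ; zero; suc; NonZero; _<_; z<s; s<s)
open import Data.Nat.Properties using (_≟_; suc-injective; <-irrefl)
open import Data.Product.Base using (_×_; _,_; proj₁; proj₂; ∃₂; ∃-syntax; map₁; uncurry; zip′)
open import Data.Product.Properties using (,-injectiveʳ)
open import Data.Sum.Base using (_⊎_; inj₁; inj₂; [_,_]′; assocʳ; assocˡ)
open import Data.Vec.Base as Vec using (Vec; []; _∷_; fromList; toList)
open import Data.Vec.Properties using (toList-++)
open import Function.Base using (_∘_; id)
open import Function.Bundles using (_⇔_; mk⇔)
open import Function.Definitions using (Injective)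
open import Level using (Level)
open import Relation.Binary.PropositionalEquality using (_≡_; _≢_; refl; sym; trans; cong; cong₂; subst)
open import Relation.Nullary using (¬_; yes; no; contradiction; recompute)
open import Relation.Unary using (Pred)

-- Cutting and tabulating words

++-injective : ∀ {a} {A : Set a} (u u′ : List A) {v v′} →
               length u ≡ length u′ → u ++ v ≡ u′ ++ v′ → u ≡ u′ × v ≡ v′
++-injective []      []       _   eq = refl , eq
++-injective (_ ∷ u) (_ ∷ u′) len eq with ∷-injective eq
... | refl , eq′ with ++-injective u u′ (suc-injective len) eq′
...   | refl , v≡v′ = refl , v≡v′

tabulate-+ : ∀ {a} {A : Set a} m {n} (ρ : Fin (m ℕ.+ n) → A) →
             tabulate (ρ ∘ (_↑ˡ n)) ++ tabulate (ρ ∘ (m ↑ʳ_)) ≡ tabulate ρ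
tabulate-+ zero    ρ = refl
tabulate-+ (suc m) ρ = cong (ρ zero ∷_) (tabulate-+ m (ρ ∘ suc))

tabulate-lookup-cast : ∀ {a} {A : Set a} {n} (w : List A) (eq : n ≡ length w) →
                       tabulate (lookup w ∘ cast eq) ≡ w
tabulate-lookup-cast w refl = trans (tabulate-cong (cong (lookup w) ∘ cast-is-id refl)) (tabulate-lookup w)

-- The place of the cut is left existential, so that regrouping words needs no arithmetic on
-- lengths. Its uniqueness is recovered from `fits-length` or `fits*-length` where it matters.
Concat : ∀ {a p} {X : Set a} (P Q : Pred (List X) p) → Pred (List X) _
Concat P Q w = ∃₂ λ u v → u ++ v ≡ w × P u × Q v

-- The recursive form of compatibility

module Fitting {ℓ} {𝒮 : Signature ℓ} (A : Alphabet 𝒮) where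
  open Signature 𝒮
  open Forests 𝒮
  open Alphabet A

  -- Fits P t w: w is compatible with t, with "w(root) ∈ R" replaced by
  -- "w(root) ∈ P".  In Fits* Q ts w, the predicate for the j-th term (from 0) is Q j.

  mutual
    Fits : Pred Letter ℓ → Term → Pred (List Letter) ℓ
    Fits P leaf        w       = w ≡ []
    Fits P (node s ts) []      = ⊥
    Fits P (node s ts) (a ∷ w) = (P a × D s a) × Fits* (λ j → E (suc j) a) ts w

    Fits* : ∀ {n} → (ℕ → Pred Letter ℓ) → Vec Term n → Pred (List Letter) ℓ
    Fits* Q []       w = w ≡ []
    Fits* Q (t ∷ ts) w = Concat (Fits (Q 0) t) (Fits* (Q ∘ suc) ts) w

  FitsForest : Forest → Pred (List Letter) ℓ
  FitsForest f = Fits* (λ _ → R) (fromList f)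

  mutual
    fits-length : ∀ {P} t {w} → Fits P t w → length w ≡ degree t
    fits-length leaf                  refl    = refl
    fits-length (node s ts) {a ∷ w} (_ , q) = cong suc (fits*-length ts q)

    fits*-length : ∀ {n Q} (ts : Vec Term n) {w} → Fits* Q ts w → length w ≡ degrees ts
    fits*-length []       refl                 = refl
    fits*-length (t ∷ ts) (u , v , refl , p , q) =
      trans (length-++ u) (cong₂ ℕ._+_ (fits-length t p) (fits*-length ts q))

  fits-mono : ∀ {P P′ : Pred Letter ℓ} → (∀ {a} → P a → P′ a) → ∀ t {w} → Fits P t w → Fits P′ t w
  fits-mono P⊆P′ leaf                p             = p
  fits-mono P⊆P′ (node s ts) {_ ∷ _} ((p , d) , q) = (P⊆P′ p , d) , q

  fits*-mono : ∀ {n} {Q Q′ : ℕ → Pred Letter ℓ} → (∀ {j a} → Q j a → Q′ j a) →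
               ∀ (ts : Vec Term n) {w} → Fits* Q ts w → Fits* Q′ ts w
  fits*-mono Q⊆Q′ []       p                    = p
  fits*-mono Q⊆Q′ (t ∷ ts) (u , v , eq , p , q) = u , v , eq , fits-mono Q⊆Q′ t p , fits*-mono Q⊆Q′ ts q

  fits-[·]⇒ : ∀ t {w} → FitsForest (t ∷ []) w → Fits R t w
  fits-[·]⇒ t (u , _ , refl , p , refl) = subst (Fits R t) (sym (++-identityʳ u)) p

  fits-[·]⇐ : ∀ t {w} → Fits R t w → FitsForest (t ∷ []) w
  fits-[·]⇐ t {w} p = w , [] , ++-identityʳ w , p , refl

  -- In a forest every term carries the same predicate `R`, so no shift of the index `j` arises when
  -- the forest is cut between two terms.
  fits-++⇒ : ∀ f g {w} → FitsForest (f ++ g) w → Concat (FitsForest f) (FitsForest g) w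
  fits-++⇒ []      g {w} q = [] , w , refl , refl , q
  fits-++⇒ (t ∷ f) g (u , _ , refl , p , q) with fits-++⇒ f g q
  ... | v , w , refl , q₁ , q₂ = u ++ v , w , ++-assoc u v w , (u , v , refl , p , q₁) , q₂

  fits-++⇐ : ∀ f g {w} → Concat (FitsForest f) (FitsForest g) w → FitsForest (f ++ g) w
  fits-++⇐ []      g (_ , w , refl , refl , q) = q
  fits-++⇐ (t ∷ f) g (_ , w , refl , (u , v , refl , p , q₁) , q₂) =
    u , v ++ w , sym (++-assoc u v w) , p , fits-++⇐ f g (v , w , refl , q₁ , q₂)

  -- A leaf fits the empty word only, and since the predicate is the same for all terms, deleting
  -- one does not disturb the terms after it.
  fits-rd⇒ : ∀ f {w} → FitsForest (forest (rd f)) w → FitsForest f w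
  fits-rd⇒ []              q                     = q
  fits-rd⇒ (leaf ∷ f)      {w} q                 = [] , w , refl , refl , fits-rd⇒ f q
  fits-rd⇒ (node s ts ∷ f) (u , v , eq , p , q) = u , v , eq , p , fits-rd⇒ f q

  fits-rd⇐ : ∀ f {w} → FitsForest f w → FitsForest (forest (rd f)) w
  fits-rd⇐ []              q                           = q
  fits-rd⇐ (leaf ∷ f)      (_ , _ , refl , refl , q) = fits-rd⇐ f q
  fits-rd⇐ (node s ts ∷ f) (u , v , eq , p , q)      = u , v , eq , p , fits-rd⇐ f q

  -- The conditions of `Compatible` on a function of the node numbers. The general `Q` covers both
  -- the roots of a forest and the children of a node, as the recursion passes from one to the
  -- other.
  record Labelling {n} (Q : ℕ → Pred Letter ℓ) (ts : Vec Term n) (ρ : Fin (degrees ts) → Letter) : Set ℓ where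
    field
      at-root  : ∀ {j i} → RootOf ts j i → Q (toℕ j) (ρ i)
      at-node  : ∀ i → D (decorations ts i) (ρ i)
      at-child : ∀ {j} .{{_ : NonZero j}} {i i′} → Child* ts j i i′ → E j (ρ i) (ρ i′)

  open Labelling

  decorations-↑ˡ : ∀ {n} t (ts : Vec Term n) i → decorations (t ∷ ts) (i ↑ˡ degrees ts) ≡ decoration t i
  decorations-↑ˡ t ts i = cong [ decoration t , decorations ts ]′ (splitAt-↑ˡ (degree t) i (degrees ts))

  decorations-↑ʳ : ∀ {n} t (ts : Vec Term n) i → decorations (t ∷ ts) (degree t ↑ʳ i) ≡ decorations ts i
  decorations-↑ʳ t ts i = cong [ decoration t , decorations ts ]′ (splitAt-↑ʳ (degree t) (degrees ts) i)

  labelling-tail : ∀ {n Q t} {ts : Vec Term n} {ρ} → Labelling Q (t ∷ ts) ρ → Labelling (Q ∘ suc) ts (ρ ∘ (degree t ↑ʳ_))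
  labelling-tail {t = t} {ts} {ρ} l = record
    { at-root  = λ r → at-root l (there r)
    ; at-node  = λ i → subst (λ s → D s (ρ (degree t ↑ʳ i))) (decorations-↑ʳ t ts i) (at-node l (degree t ↑ʳ i))
    ; at-child = λ c → at-child l (there c)
    }

  -- The roots of `us` are the children of node `zero`, counted from 0 by `RootOf` and from 1 by
  -- `Child`; their root condition is therefore an edge condition with index `suc j`.
  labelling-children : ∀ {n Q s us} {ts : Vec Term n} {ρ} → Labelling Q (node s us ∷ ts) ρ →
                       Labelling (λ j → E (suc j) (ρ zero)) us (λ i → ρ (suc (i ↑ˡ degrees ts)))
  labelling-children {s = s} {us} {ts} {ρ} l = record
    { at-root  = λ r → at-child l (here (top r))
    ; at-node  = λ i → subst (λ s → D s (ρ (suc (i ↑ˡ degrees ts)))) (decorations-↑ˡ (node s us) ts (suc i)) (at-node l (suc (i ↑ˡ degrees ts)))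
    ; at-child = λ c → at-child l (here (below c))
    }

  labelling-∷ : ∀ {n Q s us} {ts : Vec Term n} {ρ} → Q 0 (ρ zero) → D s (ρ zero) →
                Labelling (λ j → E (suc j) (ρ zero)) us (λ i → ρ (suc (i ↑ˡ degrees ts))) →
                Labelling (Q ∘ suc) ts (ρ ∘ (degree (node s us) ↑ʳ_)) → Labelling Q (node s us ∷ ts) ρ
  labelling-∷ {Q = Q} {s} {us} {ts} {ρ} q d l₁ l₂ = record { at-root = root ; at-node = decorated ; at-child = edge }
    where
    root : ∀ {j i} → RootOf (node s us ∷ ts) j i → Q (toℕ j) (ρ i)
    root here      = q
    root (there r) = at-root l₂ r

    decorated : ∀ i → D (decorations (node s us ∷ ts) i) (ρ i)
    decorated zero = d
    decorated (suc i) with splitAt (degrees us) i in eq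
    ... | inj₁ i₁ = subst (λ i → D (decorations us i₁) (ρ (suc i))) (splitAt⁻¹-↑ˡ eq) (at-node l₁ i₁)
    ... | inj₂ i₂ = subst (λ i → D (decorations ts i₂) (ρ (suc i))) (splitAt⁻¹-↑ʳ eq) (at-node l₂ i₂)

    edge : ∀ {j} .{{_ : NonZero j}} {i i′} → Child* (node s us ∷ ts) j i i′ → E j (ρ i) (ρ i′)
    edge (here (top r))   = at-root l₁ r
    edge (here (below c)) = at-child l₁ c
    edge (there c)        = at-child l₂ c

  labelling⇒fits* : ∀ {n Q} (ts : Vec Term n) ρ → Labelling Q ts ρ → Fits* Q ts (tabulate ρ)
  labelling⇒fits* []               ρ l = refl
  labelling⇒fits* (leaf ∷ ts)      ρ l = [] , _ , refl , refl , labelling⇒fits* ts ρ (labelling-tail l)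
  labelling⇒fits* (node s us ∷ ts) ρ l =
    _ , _ , tabulate-+ (suc (degrees us)) ρ
    , ((at-root l here , at-node l zero) , labelling⇒fits* us _ (labelling-children l))
    , labelling⇒fits* ts _ (labelling-tail l)

  -- The word is a variable tied to `tabulate ρ` by an equation, so that the factorization provided
  -- by `Fits*` can be matched on.
  fits*⇒labelling : ∀ {n Q} (ts : Vec Term n) ρ {w} → w ≡ tabulate ρ → Fits* Q ts w → Labelling Q ts ρ
  fits*⇒labelling [] ρ _ _ = record { at-root = λ () ; at-node = λ () ; at-child = λ () }
  fits*⇒labelling {Q = Q} (leaf ∷ ts) ρ eq (_ , _ , refl , refl , q) = record
    { at-root = λ { (there r) → at-root l r } ; at-node = at-node l ; at-child = λ { (there c) → at-child l c } }
    where
    l : Labelling (Q ∘ suc) ts ρ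
    l = fits*⇒labelling ts ρ eq q
  fits*⇒labelling {Q = Q} (node s us ∷ ts) ρ eq (a ∷ u , v , refl , ((p , d) , q₁) , q₂)
    -- The given cut and the cut of `tabulate ρ` after the first term have first parts of equal
    -- length, so they coincide.
    with ++-injective (a ∷ u) (tabulate (ρ ∘ (_↑ˡ degrees ts)))
           (trans (fits-length {P = Q 0} (node s us) ((p , d) , q₁))
                  (sym (length-tabulate (ρ ∘ (_↑ˡ degrees ts)))))
           (trans eq (sym (tabulate-+ (suc (degrees us)) ρ)))
  ... | u≡ , v≡ with ∷-injective u≡
  ...   | refl , u≡′ = labelling-∷ p d (fits*⇒labelling us _ u≡′ q₁) (fits*⇒labelling ts _ v≡ q₂)

  compatible⇒fits : ∀ f {w} → Compatible A f w → FitsForest f w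
  compatible⇒fits f {w} comp = subst (FitsForest f) (tabulate-lookup-cast w (sym length-≡))
    (labelling⇒fits* (fromList f) letter record
      { at-root = λ r → root-∈R _ (_ , r) ; at-node = node-∈D ; at-child = λ c → child-∈E _ _ _ c })
    where open Compatible comp

  fits⇒compatible : ∀ f {w} → FitsForest f w → Compatible A f w
  fits⇒compatible f {w} q = record
    { length-≡ = len
    ; root-∈R  = λ _ (_ , r) → at-root l r
    ; node-∈D  = at-node l
    ; child-∈E = λ _ _ _ c → at-child l c
    }
    where
    len : length w ≡ deg f
    len = fits*-length (fromList f) q

    l : Labelling (λ _ → R) (fromList f) (lookup w ∘ cast (sym len))
    l = fits*⇒labelling (fromList f) _ (sym (tabulate-lookup-cast w (sym len))) q

-- Words of unpadded positions and their parsing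

module PathWords {ℓ} (𝒮 : Signature ℓ) where
  open Signature 𝒮
  open Forests 𝒮
  open Alphabet (positions 𝒮)
  open Fitting (positions 𝒮)

  -- The shift to `suc j` keeps every entry of a path nonzero.
  child : List ℕ → ℕ → List ℕ
  child u j = u ++ suc j ∷ []

  mutual
    pathWord : List ℕ → Term → List Letter
    pathWord u leaf        = []
    pathWord u (node s ts) = (s , u) ∷ pathWord* (child u) ts

    pathWord* : ∀ {n} → (ℕ → List ℕ) → Vec Term n → List Letter
    pathWord* p []       = []
    pathWord* p (t ∷ ts) = pathWord (p 0) t ++ pathWord* (p ∘ suc) ts

  forestWord : Forest → List Letter
  forestWord f = pathWord* (λ _ → []) (fromList f)

  mutual
    fits-pathWord : ∀ {P u} → (∀ {s} → P (s , u)) → ∀ t → Fits P t (pathWord u t)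
    fits-pathWord         p leaf        = refl
    fits-pathWord {u = u} p (node s ts) =
      -- The witness `0` is the number of padding zeros after the index of the child.
      (p , u , refl) , fits*-pathWord* (λ {j} {s′} → s , u , s′ , 0 , refl , refl) ts

    fits*-pathWord* : ∀ {n Q p} → (∀ {j s} → Q j (s , p j)) → (ts : Vec Term n) → Fits* Q ts (pathWord* p ts)
    fits*-pathWord* q []       = refl
    fits*-pathWord* q (t ∷ ts) = _ , _ , refl , fits-pathWord q t , fits*-pathWord* q ts

  ZeroFree : Pred Letter _
  ZeroFree (s , u) = All NonZero u

  mutual
    pathWord-zeroFree : ∀ {u} → All NonZero u → ∀ t → All ZeroFree (pathWord u t)
    pathWord-zeroFree nz leaf        = []
    pathWord-zeroFree nz (node s ts) = nz ∷ pathWord*-zeroFree (λ j → All.++⁺ nz (_ ∷ [])) ts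

    pathWord*-zeroFree : ∀ {n p} → (∀ j → All NonZero (p j)) → (ts : Vec Term n) → All ZeroFree (pathWord* p ts)
    pathWord*-zeroFree nz []       = []
    pathWord*-zeroFree nz (t ∷ ts) = All.++⁺ (pathWord-zeroFree (nz 0) t) (pathWord*-zeroFree (nz ∘ suc) ts)

  -- A positive number of padding zeros would put a zero into the position of `a`.
  zeroFree-edge : ∀ {j s u a} → E (suc j) (s , u) a → ZeroFree a → proj₂ a ≡ child u j
  zeroFree-edge         (_ , _ , _ , zero  , refl , refl) _  = refl
  zeroFree-edge {u = u} (_ , _ , _ , suc l , refl , refl) nz with All.++⁻ʳ u nz
  ... | _ ∷ record { nonZero = () } ∷ _

  zeroFree-root : ∀ {a} → R a → ZeroFree a → proj₂ a ≡ []
  zeroFree-root (_ , zero  , refl) _                           = refl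
  zeroFree-root (_ , suc l , refl) (record { nonZero = () } ∷ _)

  mutual
    -- The predicate on the root pins its position and `D` pins its decoration. The edges then pin
    -- the positions of the children, by `zeroFree-edge`, and so on downwards.
    zeroFree-fits : ∀ {P u} → (∀ {a} → P a → ZeroFree a → proj₂ a ≡ u) →
                    ∀ t {w} → Fits P t w → All ZeroFree w → w ≡ pathWord u t
    zeroFree-fits h leaf                refl                 _          = refl
    zeroFree-fits h (node s ts) {_ ∷ _} ((p , _ , refl) , q) (nz ∷ nzs) with h p nz
    ... | refl = cong (_ ∷_) (zeroFree-fits* zeroFree-edge ts q nzs)

    zeroFree-fits* : ∀ {n Q p} → (∀ {j a} → Q j a → ZeroFree a → proj₂ a ≡ p j) →
                     ∀ (ts : Vec Term n) {w} → Fits* Q ts w → All ZeroFree w → w ≡ pathWord* p ts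
    zeroFree-fits* h []       refl                     _  = refl
    zeroFree-fits* h (t ∷ ts) (u , v , refl , p , q) nz =
      cong₂ _++_ (zeroFree-fits h t p (All.++⁻ˡ u nz)) (zeroFree-fits* h ts q (All.++⁻ʳ u nz))

  -- A lookahead condition for parsing: the first letter of `r`, if there is one, lies outside the
  -- subtree at `u`.
  Avoids : List ℕ → Pred (List Letter) ℓ
  Avoids u r = ∀ {s z r′} → r ≢ (s , u ++ z) ∷ r′

  avoids-++ : ∀ u v {r} → Avoids u r → Avoids (u ++ v) r
  avoids-++ u v av eq = av (trans eq (cong (λ x → (_ , x) ∷ _) (++-assoc u v _)))

  -- Leaves contribute no letters, so the first letter is either at some `p j` or the first letter
  -- of `r`.
  avoids-pathWord* : ∀ {n p u r} → (∀ j {z} → p j ≢ u ++ z) → (ts : Vec Term n) → Avoids u r → Avoids u (pathWord* p ts ++ r)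
  avoids-pathWord* p≢ []              av = av
  avoids-pathWord* p≢ (leaf ∷ ts)     av = avoids-pathWord* (p≢ ∘ suc) ts av
  avoids-pathWord* p≢ (node _ _ ∷ ts) av = λ eq → p≢ 0 (,-injectiveʳ (∷-injectiveˡ eq))

  avoids-head : ∀ {u s r r′} → Avoids u r → r ≢ (s , u) ∷ r′
  avoids-head {u} av eq = av (trans eq (cong (λ x → (_ , x) ∷ _) (sym (++-identityʳ u))))

  -- Only `i < j` is considered: in left-to-right parsing the subtree at `p i` is followed by those
  -- at later indices.
  PrefixFree : (ℕ → List ℕ) → Set
  PrefixFree p = ∀ {i j z} → i < j → p j ≢ p i ++ z

  child-prefixFree : ∀ u → PrefixFree (child u)
  child-prefixFree u {i} i<j eq with ++-cancelˡ u _ _ (trans eq (++-assoc u (suc i ∷ []) _))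
  ... | refl = <-irrefl refl i<j

  -- The letters of a subtree at u are exactly the initial ones whose
  -- position extends u, so a concatenation of path words can be parsed from left to right.

  pathWord*-injective : ∀ {n} (ts ts′ : Vec Term n) {p r r′} → PrefixFree p →
                        (∀ j → Avoids (p j) r) → (∀ j → Avoids (p j) r′) →
                        pathWord* p ts ++ r ≡ pathWord* p ts′ ++ r′ → ts ≡ ts′ × r ≡ r′
  pathWord*-injective []          []          pf av av′ eq = refl , eq
  pathWord*-injective (leaf ∷ ts) (leaf ∷ ts′) pf av av′ eq
    with pathWord*-injective ts ts′ (pf ∘ s<s) (av ∘ suc) (av′ ∘ suc) eq
  ... | refl , r≡r′ = refl , r≡r′
  pathWord*-injective (leaf ∷ ts) (node s us ∷ ts′) pf av av′ eq =
    -- The right-hand word begins with a letter at `p 0`, while the left-hand one, having a leaf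
    -- there, has only later subtrees and `r` to offer.
    contradiction eq (avoids-head (avoids-pathWord* (λ _ → pf z<s) ts (av 0)))
  pathWord*-injective (node s us ∷ ts) (leaf ∷ ts′) pf av av′ eq =
    contradiction (sym eq) (avoids-head (avoids-pathWord* (λ _ → pf z<s) ts′ (av′ 0)))
  pathWord*-injective (node s us ∷ ts) (node s′ us′ ∷ ts′) {p} {r} {r′} pf av av′ eq with ∷-injective eq
  ... | refl , eq₁
    -- For the children of this root, the remainder consists of the later subtrees followed by the
    -- old remainder. It avoids `p 0`, hence every child of `p 0`.
    with pathWord*-injective us us′ (child-prefixFree (p 0))
           (λ j → avoids-++ (p 0) _ (avoids-pathWord* (λ _ → pf z<s) ts (av 0)))
           (λ j → avoids-++ (p 0) _ (avoids-pathWord* (λ _ → pf z<s) ts′ (av′ 0)))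
           (trans (sym (++-assoc (pathWord* (child (p 0)) us) _ r)) (trans eq₁ (++-assoc (pathWord* (child (p 0)) us′) _ r′)))
  ...   | refl , eq₂ with pathWord*-injective ts ts′ (pf ∘ s<s) (av ∘ suc) (av′ ∘ suc) eq₂
  ...     | refl , r≡r′ = refl , r≡r′

  -- Every root has the empty position, which extends no `child [] j`; the next root thus marks the
  -- end of the preceding term.
  forestWord-avoids : ∀ f j → Avoids (child [] j) (forestWord f)
  forestWord-avoids f j = subst (Avoids (child [] j)) (++-identityʳ (forestWord f))
    (avoids-pathWord* {u = child [] j} (λ _ ()) (fromList f) (λ ()))

  -- The roots share one position, so they are not prefix-free, and `pathWord*-injective` is applied
  -- below each root instead. Reducedness enters because a leaf leaves no trace in the word.
  forestWord-injective : ∀ f g → Reduced f → Reduced g → forestWord f ≡ forestWord g → f ≡ g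
  forestWord-injective []              []               _          _          _  = refl
  forestWord-injective (leaf ∷ f)      _                (≢leaf ∷ _) _         _  = contradiction refl ≢leaf
  forestWord-injective _               (leaf ∷ g)       _     (≢leaf ∷ _)     _  = contradiction refl ≢leaf
  forestWord-injective (node s us ∷ f) (node s′ us′ ∷ g) (_ ∷ f-red) (_ ∷ g-red) eq with ∷-injective eq
  ... | refl , eq′ with pathWord*-injective us us′ (child-prefixFree []) (forestWord-avoids f) (forestWord-avoids g) eq′
  ...   | refl , eq″ = cong (_ ∷_) (forestWord-injective f g f-red g-red eq″)

  forestWord-compatible : ∀ f → Compatible (positions 𝒮) f (forestWord f)
  forestWord-compatible f = fits⇒compatible f (fits*-pathWord* (λ {_} {s} → s , 0 , refl) (fromList f))

  -- A word without zeros leaves no freedom in the exponents of 0 in R and E, so it can only be the path word of g.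

  compatible⇒≡ : ∀ f g → Compatible (positions 𝒮) (forest g) (forestWord (forest f)) → f ≡ g
  compatible⇒≡ (f , f-red) (g , g-red) comp with forestWord-injective f g
    -- The proofs of reducedness are irrelevant fields, but being reduced is decidable.
    (recompute (all? nonLeaf? f) f-red) (recompute (all? nonLeaf? g) g-red)
    (zeroFree-fits* zeroFree-root (fromList g) (compatible⇒fits g comp) (pathWord*-zeroFree (λ _ → []) (fromList f)))
  ... | refl = refl

-- Enumerations and double counting

open Enumeration

-- Both lists are free of repetitions and have the same members. Hence sums over enumerations of `P`
-- depend on `P` alone, and an identity of sums can be proved by enumerating one set in two ways.
enumeration-↭ : ∀ {a p} {X : Set a} {P : Pred X p} (e e′ : Enumeration P) → elements e ↭ elements e′
enumeration-↭ e e′ = ∼bag⇒↭ (unique∧set⇒bag (unique e) (unique e′)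
  (mk⇔ (complete e′ ∘ sound e) (complete e ∘ sound e′)))

concatMap-unique : ∀ {a b} {X : Set a} {Y : Set b} (f : X → List Y) → (∀ x → Unique (f x)) →
                   (∀ {x x′ y} → y ∈ f x → y ∈ f x′ → x ≡ x′) → ∀ {xs} → Unique xs → Unique (concatMap f xs)
concatMap-unique f uf inj []             = []
concatMap-unique f uf inj (x∉xs ∷ uxs) = Unique.++⁺ (uf _) (concatMap-unique f uf inj uxs)
  λ (y∈ , y∈′) → let x′ , x′∈ , y∈fx′ = find (∈-concatMap⁻ f y∈′) in All.lookup x∉xs x′∈ (inj y∈ y∈fx′)

-- That `y` determines `x` makes the lists being concatenated disjoint.
enumeration-bind : ∀ {a b p q r} {X : Set a} {Y : Set b} {P : Pred X p} {Q : X → Pred Y q} {S : Pred Y r} →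
                   Enumeration P → (∀ x → Enumeration (Q x)) → (∀ {x x′ y} → Q x y → Q x′ y → x ≡ x′) →
                   (∀ {x y} → P x → Q x y → S y) → (∀ {y} → S y → ∃[ x ] P x × Q x y) → Enumeration S
enumeration-bind e e′ inj sound′ complete′ = record
  { elements = concatMap (elements ∘ e′) (elements e)
  ; unique   = concatMap-unique (elements ∘ e′) (unique ∘ e′) (λ y∈ y∈′ → inj (sound (e′ _) y∈) (sound (e′ _) y∈′)) (unique e)
  ; sound    = λ y∈ → let x , x∈ , y∈′ = find (∈-concatMap⁻ (elements ∘ e′) y∈) in sound′ (sound e x∈) (sound (e′ x) y∈′)
  ; complete = λ s → let x , p , q = complete′ s in ∈-concatMap⁺ (elements ∘ e′) (lose (complete e p) (complete (e′ x) q))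
  }

enumeration-× : ∀ {a b c p q r} {X : Set a} {Y : Set b} {Z : Set c} {P : Pred X p} {Q : Pred Y q} {S : Pred Z r} →
                (f : X → Y → Z) → (∀ {x x′ y y′} → f x y ≡ f x′ y′ → x ≡ x′ × y ≡ y′) →
                (∀ {x y} → P x → Q y → S (f x y)) → (∀ {z} → S z → ∃₂ λ x y → P x × Q y × z ≡ f x y) →
                Enumeration P → Enumeration Q → Enumeration S
enumeration-× {S = S} f inj sound′ complete′ e e′ = record
  { elements = cartesianProductWith f (elements e) (elements e′)
  ; unique   = Unique.cartesianProductWith⁺ f inj (unique e) (unique e′)
  ; sound    = λ z∈ → let x , y , x∈ , y∈ , eq = ∈-cartesianProductWith⁻ f (elements e) (elements e′) z∈ in
                      subst S (sym eq) (sound′ (sound e x∈) (sound e′ y∈))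
  ; complete = λ s → let x , y , p , q , eq = complete′ s in
                     subst (_∈ cartesianProductWith f (elements e) (elements e′)) (sym eq)
                       (∈-cartesianProductWith⁺ f (complete e p) (complete e′ q))
  }

partitionSums-++ : ∀ {a b} {A : Set a} {B : Set b} (w w′ : List (A ⊎ B)) →
                   partitionSums (w ++ w′) ≡ zip′ _++_ _++_ (partitionSums w) (partitionSums w′)
partitionSums-++ []           w′ = refl
partitionSums-++ (inj₁ a ∷ w) w′ rewrite partitionSums-++ w w′ = refl
partitionSums-++ (inj₂ b ∷ w) w′ rewrite partitionSums-++ w w′ = refl

module _ {a b} {A : Set a} {B : Set b} where

  Split : List A → List B → Pred ((List A × List B) × (List A × List B)) _
  Split u v ((u₁ , v₁) , (u₂ , v₂)) = u₁ ++ u₂ ≡ u × v₁ ++ v₂ ≡ v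

  splits : ∀ u v → Enumeration (Split u v)
  splits u v = enumeration-× (λ (u₁ , u₂) (v₁ , v₂) → (u₁ , v₁) , (u₂ , v₂)) (λ { refl → refl , refl })
    _,_ (λ {((u₁ , v₁) , (u₂ , v₂))} (p , q) → (u₁ , u₂) , (v₁ , v₂) , p , q , refl)
    (factorizations u) (factorizations v)

  -- The set to be counted twice: either shuffle `u` and `v` and then cut the result, or cut `u` and
  -- `v` and then shuffle the first parts and the second parts.
  Factors : List A → List B → Pred (List (A ⊎ B) × List (A ⊎ B)) _
  Factors u v (w₁ , w₂) = partitionSums (w₁ ++ w₂) ≡ (u , v)

  factors-shuffles : ∀ u v → Enumeration (Factors u v)
  factors-shuffles u v = enumeration-bind (shuffles u v) factorizations
    (λ p q → trans (sym p) q) (λ { p refl → p }) (λ p → _ , p , refl)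

  factors-splits : ∀ u v → Enumeration (Factors u v)
  factors-splits u v = enumeration-bind (splits u v)
    (λ ((u₁ , v₁) , (u₂ , v₂)) → enumeration-× {S = λ (w₁ , w₂) → partitionSums w₁ ≡ (u₁ , v₁) × partitionSums w₂ ≡ (u₂ , v₂)}
      _,_ (λ { refl → refl , refl }) _,_ (λ (p , q) → _ , _ , p , q , refl) (shuffles u₁ v₁) (shuffles u₂ v₂))
    (λ (p , q) (p′ , q′) → cong₂ _,_ (trans (sym p) p′) (trans (sym q) q′))
    (λ { {y = w₁ , w₂} (refl , refl) (p , q) → trans (partitionSums-++ w₁ w₂) (cong₂ (zip′ _++_ _++_) p q) })
    (λ {(w₁ , w₂)} p → (partitionSums w₁ , partitionSums w₂)
                     , (cong proj₁ (eq w₁ w₂ p) , cong proj₂ (eq w₁ w₂ p)) , refl , refl)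
    where
    eq : ∀ w₁ w₂ → Factors u v (w₁ , w₂) → zip′ _++_ _++_ (partitionSums w₁) (partitionSums w₂) ≡ (u , v)
    eq w₁ w₂ p = trans (sym (partitionSums-++ w₁ w₂)) p

-- Finite sums, indicators and convolutions

module Summation {c k ℓ} (em : ExcludedMiddle ℓ) (K : CommutativeRing c k) (𝒮 : Signature ℓ) where
  open Realization em K 𝒮 using (∑; ∑-zero; 𝟙[_])
  open CommutativeRing K hiding (zero) renaming (Carrier to 𝕂; refl to ≈-refl; sym to ≈-sym; trans to ≈-trans)
  open import Algebra.Properties.CommutativeSemigroup +-commutativeSemigroup using () renaming (interchange to +-interchange)
  open import Algebra.Properties.CommutativeSemigroup *-commutativeSemigroup using () renaming (interchange to *-interchange)
  open import Relation.Binary.Reasoning.Setoid setoid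

  module _ {a} {X : Set a} where

    ∑-cong∈ : ∀ {g h : X → 𝕂} xs → (∀ {x} → x ∈ xs → g x ≈ h x) → ∑ xs g ≈ ∑ xs h
    ∑-cong∈ []       g≈h = ≈-refl
    ∑-cong∈ (x ∷ xs) g≈h = +-cong (g≈h (here refl)) (∑-cong∈ xs (g≈h ∘ there))

    ∑-cong : ∀ {g h : X → 𝕂} xs → (∀ x → g x ≈ h x) → ∑ xs g ≈ ∑ xs h
    ∑-cong xs g≈h = ∑-cong∈ xs λ {x} _ → g≈h x

    ∑-++ : ∀ (g : X → 𝕂) xs ys → ∑ (xs ++ ys) g ≈ ∑ xs g + ∑ ys g
    ∑-++ g []       ys = ≈-sym (+-identityˡ _)
    ∑-++ g (x ∷ xs) ys = ≈-trans (+-congˡ (∑-++ g xs ys)) (≈-sym (+-assoc _ _ _))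

    ∑-map : ∀ {b} {Y : Set b} (g : X → 𝕂) (f : Y → X) ys → ∑ (map f ys) g ≈ ∑ ys (g ∘ f)
    ∑-map g f []       = ≈-refl
    ∑-map g f (y ∷ ys) = +-congˡ (∑-map g f ys)

    ∑-+ : ∀ (g h : X → 𝕂) xs → ∑ xs (λ x → g x + h x) ≈ ∑ xs g + ∑ xs h
    ∑-+ g h []       = ≈-sym (+-identityˡ 0#)
    ∑-+ g h (x ∷ xs) = ≈-trans (+-congˡ (∑-+ g h xs)) (+-interchange _ _ _ _)

    ∑-*ˡ : ∀ μ (g : X → 𝕂) xs → ∑ xs (λ x → μ * g x) ≈ μ * ∑ xs g
    ∑-*ˡ μ g []       = ≈-sym (zeroʳ μ)
    ∑-*ˡ μ g (x ∷ xs) = ≈-trans (+-congˡ (∑-*ˡ μ g xs)) (≈-sym (distribˡ μ _ _))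

    ∑-*ʳ : ∀ μ (g : X → 𝕂) xs → ∑ xs (λ x → g x * μ) ≈ ∑ xs g * μ
    ∑-*ʳ μ g []       = ≈-sym (zeroˡ μ)
    ∑-*ʳ μ g (x ∷ xs) = ≈-trans (+-congˡ (∑-*ʳ μ g xs)) (≈-sym (distribʳ μ _ _))

    ∑-↭ : ∀ (g : X → 𝕂) {xs ys} → xs ↭ ys → ∑ xs g ≈ ∑ ys g
    ∑-↭ g refl         = ≈-refl
    ∑-↭ g (prep x p)   = +-congˡ (∑-↭ g p)
    ∑-↭ g (swap x y p) = ≈-trans (≈-sym (+-assoc _ _ _)) (≈-trans (+-cong (+-comm _ _) (∑-↭ g p)) (+-assoc _ _ _))
    ∑-↭ g (↭-trans p q)  = ≈-trans (∑-↭ g p) (∑-↭ g q)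

    ∑-single : ∀ {g : X → 𝕂} {xs x} → Unique xs → x ∈ xs → (∀ {y} → y ∈ xs → y ≢ x → g y ≈ 0#) → ∑ xs g ≈ g x
    ∑-single {xs = x ∷ xs} (x∉xs ∷ _) (here refl) g≈0 =
      ≈-trans (+-congˡ (∑-zero xs λ y∈ → g≈0 (there y∈) λ { refl → All.lookup x∉xs y∈ refl })) (+-identityʳ _)
    ∑-single (x∉xs ∷ uxs) (there x∈) g≈0 =
      ≈-trans (+-cong (g≈0 (here refl) (All.lookup x∉xs x∈)) (∑-single uxs x∈ (g≈0 ∘ there))) (+-identityˡ _)

  ∑-concatMap : ∀ {a b} {X : Set a} {Y : Set b} (g : Y → 𝕂) (f : X → List Y) xs →
                ∑ (concatMap f xs) g ≈ ∑ xs λ x → ∑ (f x) g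
  ∑-concatMap g f []       = ≈-refl
  ∑-concatMap g f (x ∷ xs) = ≈-trans (∑-++ g (f x) _) (+-congˡ (∑-concatMap g f xs))

  ∑-cartesian : ∀ {a b c} {X : Set a} {Y : Set b} {Z : Set c} (g : Z → 𝕂) (f : X → Y → Z) xs ys →
                ∑ (cartesianProductWith f xs ys) g ≈ ∑ xs λ x → ∑ ys λ y → g (f x y)
  ∑-cartesian g f []       ys = ≈-refl
  ∑-cartesian g f (x ∷ xs) ys = ≈-trans (∑-++ g (map (f x) ys) _) (+-cong (∑-map g (f x) ys) (∑-cartesian g f xs ys))

  ∑-comm : ∀ {a b} {X : Set a} {Y : Set b} (g : X → Y → 𝕂) xs ys →
           ∑ xs (λ x → ∑ ys (g x)) ≈ ∑ ys λ y → ∑ xs λ x → g x y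
  ∑-comm g []       ys = ≈-sym (∑-zero ys λ _ → ≈-refl)
  ∑-comm g (x ∷ xs) ys = ≈-trans (+-congˡ (∑-comm g xs ys)) (≈-sym (∑-+ (g x) (λ y → ∑ xs λ x → g x y) ys))

  ∑-*-∑ : ∀ {a b} {X : Set a} {Y : Set b} (g : X → 𝕂) (h : Y → 𝕂) xs ys →
          ∑ xs g * ∑ ys h ≈ ∑ xs λ x → ∑ ys λ y → g x * h y
  ∑-*-∑ g h xs ys = ≈-trans (≈-sym (∑-*ʳ (∑ ys h) g xs)) (∑-cong xs λ x → ≈-sym (∑-*ˡ (g x) h ys))

  𝟙-true : ∀ {P} → P → 𝟙[ P ] ≈ 1#
  𝟙-true {P} p with em {P}
  ... | yes _ = ≈-refl
  ... | no ¬p = contradiction p ¬p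

  𝟙-false : ∀ {P} → ¬ P → 𝟙[ P ] ≈ 0#
  𝟙-false {P} ¬p with em {P}
  ... | yes p = contradiction p ¬p
  ... | no _  = ≈-refl

  𝟙-cong : ∀ {P Q} → (P → Q) → (Q → P) → 𝟙[ P ] ≈ 𝟙[ Q ]
  𝟙-cong {P} {Q} to from with em {P}
  ... | yes p = ≈-sym (𝟙-true (to p))
  ... | no ¬p = ≈-sym (𝟙-false (¬p ∘ from))

  𝟙-× : ∀ {P Q} → 𝟙[ P × Q ] ≈ 𝟙[ P ] * 𝟙[ Q ]
  𝟙-× {P} {Q} with em {P}
  ... | yes p = ≈-trans (𝟙-cong proj₂ (p ,_)) (≈-sym (*-identityˡ _))
  ... | no ¬p = ≈-trans (𝟙-false (¬p ∘ proj₁)) (≈-sym (zeroˡ _))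

  -- At most one summand is nonzero, so the sum registers the existence of a witness without
  -- multiplicity.
  ∑-𝟙 : ∀ {a} {X : Set a} {xs : List X} {P : Pred X ℓ} {Q} → Unique xs →
        (∀ {x y} → x ∈ xs → y ∈ xs → P x → P y → x ≡ y) →
        (∀ {x} → x ∈ xs → P x → Q) → (Q → ∃[ x ] x ∈ xs × P x) → ∑ xs (λ x → 𝟙[ P x ]) ≈ 𝟙[ Q ]
  ∑-𝟙 {xs = xs} {P} {Q} uxs at-most-one sound′ complete′ with em {Q}
  ... | yes q = let x , x∈ , p = complete′ q in
                ≈-trans (∑-single uxs x∈ λ y∈ y≢x → 𝟙-false λ p′ → y≢x (at-most-one y∈ x∈ p′ p)) (𝟙-true p)
  ... | no ¬q = ∑-zero xs λ x∈ → 𝟙-false (¬q ∘ sound′ x∈)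

  -- With `I` the factorizations of a word this is a coefficient of a product of polynomials; with
  -- `I` the splits of a pair of words, one of a product of tensors.
  convolve : ∀ {a b} {X : Set a} {Y : Set b} → List (X × Y) → (X → 𝕂) → (Y → 𝕂) → 𝕂
  convolve I p q = ∑ I λ (x , y) → p x * q y

  convolve-cong : ∀ {a b} {X : Set a} {Y : Set b} (I : List (X × Y)) {p p′ q q′} →
                  (∀ x → p x ≈ p′ x) → (∀ y → q y ≈ q′ y) → convolve I p q ≈ convolve I p′ q′
  convolve-cong I p≈p′ q≈q′ = ∑-cong I λ (x , y) → *-cong (p≈p′ x) (q≈q′ y)

  convolve-∑ : ∀ {a b d e} {X : Set a} {Y : Set b} {S : Set d} {T : Set e} (I : List (X × Y))
               (p : S → X → 𝕂) (q : T → Y → 𝕂) ss ts →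
               convolve I (λ x → ∑ ss λ s → p s x) (λ y → ∑ ts λ t → q t y) ≈
               ∑ ss λ s → ∑ ts λ t → convolve I (p s) (q t)
  convolve-∑ I p q ss ts = begin
    ∑ I (λ (x , y) → ∑ ss (λ s → p s x) * ∑ ts (λ t → q t y))       ≈⟨ ∑-cong I (λ (x , y) → ∑-*-∑ (λ s → p s x) (λ t → q t y) ss ts) ⟩
    ∑ I (λ (x , y) → ∑ ss (λ s → ∑ ts (λ t → p s x * q t y)))       ≈⟨ ∑-comm (λ (x , y) s → ∑ ts (λ t → p s x * q t y)) I ss ⟩
    ∑ ss (λ s → ∑ I (λ (x , y) → ∑ ts (λ t → p s x * q t y)))       ≈⟨ ∑-cong ss (λ s → ∑-comm (λ (x , y) t → p s x * q t y) I ts) ⟩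
    ∑ ss (λ s → ∑ ts (λ t → ∑ I (λ (x , y) → p s x * q t y)))       ∎

  -- Bilinearity of the convolution. It serves the product of two combinations as well as the list
  -- of decompositions of a sequence of terms, both being cartesian products.
  convolve-cartesian : ∀ {a b d e m} {X : Set a} {Y : Set b} {S : Set d} {T : Set e} {M : Set m} (I : List (X × Y))
                       (p : S → X → 𝕂) (q : T → Y → 𝕂) (g : M → 𝕂) (f : S → T → M) →
                       (∀ s t → g (f s t) ≈ convolve I (p s) (q t)) → ∀ ss ts →
                       ∑ (cartesianProductWith f ss ts) g ≈ convolve I (λ x → ∑ ss λ s → p s x) (λ y → ∑ ts λ t → q t y)
  convolve-cartesian I p q g f g≈ ss ts = begin
    ∑ (cartesianProductWith f ss ts) g                              ≈⟨ ∑-cartesian g f ss ts ⟩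
    ∑ ss (λ s → ∑ ts (λ t → g (f s t)))                             ≈⟨ ∑-cong ss (λ s → ∑-cong ts (g≈ s)) ⟩
    ∑ ss (λ s → ∑ ts (λ t → convolve I (p s) (q t)))                ≈⟨ convolve-∑ I p q ss ts ⟨
    convolve I (λ x → ∑ ss λ s → p s x) (λ y → ∑ ts λ t → q t y)    ∎

  -- The words satisfying `P` have one common length, so at most one cut of `w` counts.
  convolve-𝟙 : ∀ {X : Set ℓ} (P Q : Pred (List X) ℓ) {n} → (∀ {u} → P u → length u ≡ n) → ∀ w →
               convolve (elements (factorizations w)) (λ u → 𝟙[ P u ]) (λ v → 𝟙[ Q v ]) ≈ 𝟙[ Concat P Q w ]
  convolve-𝟙 P Q length-P w = ≈-trans (∑-cong (elements (factorizations w)) λ _ → ≈-sym 𝟙-×)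
    (∑-𝟙 (unique (factorizations w))
      (λ {(u , v)} {(u′ , v′)} x∈ y∈ (p , _) (p′ , _) → uncurry (cong₂ _,_)
        (++-injective u u′ (trans (length-P p) (sym (length-P p′)))
          (trans (sound (factorizations w) x∈) (sym (sound (factorizations w) y∈)))))
      (λ {(u , v)} x∈ (p , q) → u , v , sound (factorizations w) x∈ , p , q)
      (λ (u , v , eq , p , q) → (u , v) , complete (factorizations w) eq , p , q))

  module _ {a b} {A : Set a} {B : Set b} where

    -- This is (p ⊗ q)(p′ ⊗ q′) = pp′ ⊗ qq′: a split of `(u , v)` is a factorization of `u` together
    -- with one of `v`, so the sum factors.
    convolve-⊗ : ∀ u v (p p′ : List A → 𝕂) (q q′ : List B → 𝕂) →
                 convolve (elements (splits u v)) (λ (u₁ , v₁) → p u₁ * q v₁) (λ (u₂ , v₂) → p′ u₂ * q′ v₂) ≈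
                 convolve (elements (factorizations u)) p p′ * convolve (elements (factorizations v)) q q′
    convolve-⊗ u v p p′ q q′ = begin
      ∑ (elements (splits u v)) (λ ((u₁ , v₁) , (u₂ , v₂)) → (p u₁ * q v₁) * (p′ u₂ * q′ v₂))
        ≈⟨ ∑-cartesian _ _ (elements (factorizations u)) (elements (factorizations v)) ⟩
      ∑ (elements (factorizations u)) (λ (u₁ , u₂) → ∑ (elements (factorizations v)) λ (v₁ , v₂) → (p u₁ * q v₁) * (p′ u₂ * q′ v₂))
        ≈⟨ ∑-cong (elements (factorizations u)) (λ _ → ∑-cong (elements (factorizations v)) λ _ → *-interchange _ _ _ _) ⟩
      ∑ (elements (factorizations u)) (λ (u₁ , u₂) → ∑ (elements (factorizations v)) λ (v₁ , v₂) → (p u₁ * p′ u₂) * (q v₁ * q′ v₂))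
        ≈⟨ ∑-*-∑ _ _ (elements (factorizations u)) (elements (factorizations v)) ⟨
      convolve (elements (factorizations u)) p p′ * convolve (elements (factorizations v)) q q′ ∎

    -- Restriction of words to A and B turns deconcatenation into pairs of deconcatenations: θ is multiplicative.

    ∑-shuffles-convolve : ∀ (g h : List (A ⊎ B) → 𝕂) u v →
      ∑ (elements (shuffles u v)) (λ w → convolve (elements (factorizations w)) g h) ≈
      convolve (elements (splits u v)) (λ (u₁ , v₁) → ∑ (elements (shuffles u₁ v₁)) g) (λ (u₂ , v₂) → ∑ (elements (shuffles u₂ v₂)) h)
    ∑-shuffles-convolve g h u v = begin
      ∑ (elements (shuffles u v)) (λ w → ∑ (elements (factorizations w)) gh)
        ≈⟨ ∑-concatMap gh (elements ∘ factorizations) (elements (shuffles u v)) ⟨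
      ∑ (elements (factors-shuffles u v)) gh
        ≈⟨ ∑-↭ gh (enumeration-↭ (factors-shuffles u v) (factors-splits u v)) ⟩
      ∑ (elements (factors-splits u v)) gh
        ≈⟨ ∑-concatMap gh (λ ((u₁ , v₁) , (u₂ , v₂)) → cartesianProductWith _,_ (elements (shuffles u₁ v₁)) (elements (shuffles u₂ v₂))) (elements (splits u v)) ⟩
      ∑ (elements (splits u v)) (λ ((u₁ , v₁) , (u₂ , v₂)) → ∑ (cartesianProductWith _,_ (elements (shuffles u₁ v₁)) (elements (shuffles u₂ v₂))) gh)
        ≈⟨ ∑-cong (elements (splits u v)) (λ ((u₁ , v₁) , (u₂ , v₂)) → ≈-trans
             (∑-cartesian gh _,_ (elements (shuffles u₁ v₁)) (elements (shuffles u₂ v₂)))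
             (≈-sym (∑-*-∑ g h (elements (shuffles u₁ v₁)) (elements (shuffles u₂ v₂))))) ⟩
      convolve (elements (splits u v)) (λ (u₁ , v₁) → ∑ (elements (shuffles u₁ v₁)) g) (λ (u₂ , v₂) → ∑ (elements (shuffles u₂ v₂)) h) ∎
      where
      gh : List (A ⊎ B) × List (A ⊎ B) → 𝕂
      gh (w₁ , w₂) = g w₁ * h w₂

-- Fitting words over a disjoint sum

partitionSums-inj₂ : ∀ {a b} {A : Set a} {B : Set b} (v : List B) → partitionSums (map inj₂ v) ≡ ([] {A = A} , v)
partitionSums-inj₂         []      = refl
partitionSums-inj₂ {A = A} (b ∷ v) rewrite partitionSums-inj₂ {A = A} v = refl

open Alphabet

module DisjointSum {ℓ} {𝒮 : Signature ℓ} (A₁ A₂ : Alphabet 𝒮) where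
  open Forests 𝒮
  module F  = Fitting (A₁ ⧺ A₂)
  module F₂ = Fitting A₂

  mutual
    -- No edge leads from `A₂` to `A₁`, so keeping the root out of `A₁` keeps every node out of it,
    -- and between letters of `A₂` the edges are those of `A₂`.
    fits-inj₂⇒ : ∀ {P : Pred (Letter (A₁ ⧺ A₂)) ℓ} {P₂} → (∀ {a} → ¬ P (inj₁ a)) → (∀ {b} → P (inj₂ b) → P₂ b) →
                 ∀ t {w} → F.Fits P t w → ∃[ v ] w ≡ map inj₂ v × F₂.Fits P₂ t v
    fits-inj₂⇒ ¬P P⊆ leaf                     refl          = [] , refl , refl
    fits-inj₂⇒ ¬P P⊆ (node s ts) {inj₁ a ∷ w} ((p , _) , _) = contradiction p ¬P
    fits-inj₂⇒ ¬P P⊆ (node s ts) {inj₂ b ∷ w} ((p , d) , q) with fits*-inj₂⇒ (λ ()) id ts q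
    ... | v , refl , q′ = b ∷ v , refl , (P⊆ p , d) , q′

    fits*-inj₂⇒ : ∀ {n} {Q : ℕ → Pred (Letter (A₁ ⧺ A₂)) ℓ} {Q₂} → (∀ {j a} → ¬ Q j (inj₁ a)) → (∀ {j b} → Q j (inj₂ b) → Q₂ j b) →
                  ∀ (ts : Vec Term n) {w} → F.Fits* Q ts w → ∃[ v ] w ≡ map inj₂ v × F₂.Fits* Q₂ ts v
    fits*-inj₂⇒ ¬Q Q⊆ []       refl = [] , refl , refl
    fits*-inj₂⇒ ¬Q Q⊆ (t ∷ ts) (_ , _ , refl , p , q) with fits-inj₂⇒ ¬Q Q⊆ t p | fits*-inj₂⇒ ¬Q Q⊆ ts q
    ... | u , refl , p′ | v , refl , q′ = u ++ v , sym (map-++ inj₂ u v) , u , v , refl , p′ , q′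

  mutual
    fits-inj₂⇐ : ∀ {P : Pred (Letter (A₁ ⧺ A₂)) ℓ} {P₂} → (∀ {b} → P₂ b → P (inj₂ b)) →
                 ∀ t {v} → F₂.Fits P₂ t v → F.Fits P t (map inj₂ v)
    fits-inj₂⇐ P⊇ leaf                refl          = refl
    fits-inj₂⇐ P⊇ (node s ts) {_ ∷ _} ((p , d) , q) = (P⊇ p , d) , fits*-inj₂⇐ id ts q

    fits*-inj₂⇐ : ∀ {n} {Q : ℕ → Pred (Letter (A₁ ⧺ A₂)) ℓ} {Q₂} → (∀ {j b} → Q₂ j b → Q j (inj₂ b)) →
                  ∀ (ts : Vec Term n) {v} → F₂.Fits* Q₂ ts v → F.Fits* Q ts (map inj₂ v)
    fits*-inj₂⇐ Q⊇ []       refl                   = refl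
    fits*-inj₂⇐ Q⊇ (t ∷ ts) (u , v , refl , p , q) =
      map inj₂ u , map inj₂ v , sym (map-++ inj₂ u v) , fits-inj₂⇐ Q⊇ t p , fits*-inj₂⇐ Q⊇ ts q

  -- Below a letter of `A₁` the predicate on a child has again the shape `[ P₁ , R A₂ ]′`, so the
  -- induction over terms can continue. The two sides agree by computation, once `x` is a
  -- constructor.
  edge-inj₁⇒ : ∀ {j} (a : Letter A₁) x → E (A₁ ⧺ A₂) (suc j) (inj₁ a) x → [ E A₁ (suc j) a , R A₂ ]′ x
  edge-inj₁⇒ a (inj₁ _) e = e
  edge-inj₁⇒ a (inj₂ _) e = e

  edge-inj₁⇐ : ∀ {j} (a : Letter A₁) x → [ E A₁ (suc j) a , R A₂ ]′ x → E (A₁ ⧺ A₂) (suc j) (inj₁ a) x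
  edge-inj₁⇐ a (inj₁ _) e = e
  edge-inj₁⇐ a (inj₂ _) e = e

-- Linear combinations and functionals on them

module Combinations {c k ℓ} (em : ExcludedMiddle ℓ) (K : CommutativeRing c k) (𝒮 : Signature ℓ) where
  open Realization em K 𝒮
  open Summation em K 𝒮
  open CommutativeRing K hiding (zero; _-_) renaming (Carrier to 𝕂; refl to ≈-refl; sym to ≈-sym; trans to ≈-trans)
  open import Algebra.Properties.Ring ring using (-‿distribˡ-*; -0#≈0#; -‿+-comm)
  open import Algebra.Properties.CommutativeSemigroup *-commutativeSemigroup using () renaming (interchange to *-interchange)
  open import Relation.Binary.Reasoning.Setoid setoid

  module _ {B : Set ℓ} where

    -- The linear functional extending `g`; `coefficient` is the case of an indicator.
    evaluate : (B → 𝕂) → Combination B → 𝕂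
    evaluate g x = ∑ x λ (μ , b) → μ * g b

    evaluate-scale : ∀ g μ x → evaluate g (map (map₁ (μ *_)) x) ≈ μ * evaluate g x
    evaluate-scale g μ x = begin
      evaluate g (map (map₁ (μ *_)) x)        ≈⟨ ∑-map _ (map₁ (μ *_)) x ⟩
      ∑ x (λ (ν , b) → (μ * ν) * g b)         ≈⟨ ∑-cong x (λ _ → *-assoc _ _ _) ⟩
      ∑ x (λ (ν , b) → μ * (ν * g b))         ≈⟨ ∑-*ˡ μ _ x ⟩
      μ * evaluate g x                        ∎

    evaluate-neg : ∀ g x → evaluate g (map (map₁ (-_)) x) ≈ - evaluate g x
    evaluate-neg g []            = ≈-sym -0#≈0#
    evaluate-neg g ((μ , b) ∷ x) = ≈-trans (+-cong (≈-sym (-‿distribˡ-* μ (g b))) (evaluate-neg g x)) (-‿+-comm _ _)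

    evaluate-basis : ∀ g b → evaluate g (basis b) ≈ g b
    evaluate-basis g b = ≈-trans (+-identityʳ _) (*-identityˡ _)

    -- Excluded middle decides membership, so repetitions can be removed for an arbitrary `B`.
    -- Elements whose coefficients cancel are kept.
    support : ∀ (x : Combination B) → ∃[ bs ] Unique bs × All (λ (_ , b) → b ∈ bs) x
    support []            = [] , [] , []
    support ((μ , b) ∷ x) with support x
    ... | bs , ubs , x⊆bs with em {b ∈ bs}
    ...   | yes b∈ = bs , ubs , b∈ ∷ x⊆bs
    ...   | no b∉  = b ∷ bs , All.¬Any⇒All¬ bs b∉ ∷ ubs , here refl ∷ All.map there x⊆bs

    -- Collecting like terms: as `bs` has no repetitions, each term of `x` contributes at exactly
    -- one entry.
    evaluate-coefficient : ∀ g {bs} → Unique bs → ∀ x → All (λ (_ , b) → b ∈ bs) x →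
                           evaluate g x ≈ ∑ bs λ b → coefficient x b * g b
    evaluate-coefficient g {bs} ubs []            []          = ≈-sym (∑-zero bs λ _ → zeroˡ _)
    evaluate-coefficient g {bs} ubs ((μ , b) ∷ x) (b∈ ∷ x⊆bs) = begin
      μ * g b + evaluate g x
        ≈⟨ +-cong (*-congʳ (≈-sym (≈-trans (*-congˡ (𝟙-true refl)) (*-identityʳ μ)))) (evaluate-coefficient g ubs x x⊆bs) ⟩
      (μ * 𝟙[ b ≡ b ]) * g b + ∑ bs (λ b′ → coefficient x b′ * g b′)
        ≈⟨ +-congʳ (∑-single ubs b∈ λ _ b′≢b → ≈-trans (*-congʳ (≈-trans (*-congˡ (𝟙-false b′≢b)) (zeroʳ μ))) (zeroˡ _)) ⟨
      ∑ bs (λ b′ → (μ * 𝟙[ b′ ≡ b ]) * g b′) + ∑ bs (λ b′ → coefficient x b′ * g b′)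
        ≈⟨ ∑-+ _ _ bs ⟨
      ∑ bs (λ b′ → (μ * 𝟙[ b′ ≡ b ]) * g b′ + coefficient x b′ * g b′)
        ≈⟨ ∑-cong bs (λ b′ → distribʳ (g b′) _ _) ⟨
      ∑ bs (λ b′ → coefficient ((μ , b) ∷ x) b′ * g b′) ∎

    evaluate-resp : ∀ g x y → (∀ b → coefficient x b ≈ coefficient y b) → evaluate g x ≈ evaluate g y
    -- One list serves both combinations, so that their sums can be compared entry by entry.
    evaluate-resp g x y x≈y with support (x ++ y)
    ... | bs , ubs , ⊆bs = begin
      evaluate g x                          ≈⟨ evaluate-coefficient g ubs x (All.++⁻ˡ x ⊆bs) ⟩
      ∑ bs (λ b → coefficient x b * g b)    ≈⟨ ∑-cong bs (λ b → *-congʳ (x≈y b)) ⟩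
      ∑ bs (λ b → coefficient y b * g b)    ≈⟨ evaluate-coefficient g ubs y (All.++⁻ʳ x ⊆bs) ⟨
      evaluate g y                          ∎

  evaluate-linear : ∀ {B C : Set ℓ} (g : C → 𝕂) (φ : B → Combination C) x →
                    evaluate g (linear (Free C) φ x) ≈ evaluate (evaluate g ∘ φ) x
  evaluate-linear g φ []            = ≈-refl
  evaluate-linear g φ ((μ , b) ∷ x) = ≈-trans (∑-++ _ (map (map₁ (μ *_)) (φ b)) _)
    (+-cong (evaluate-scale g μ (φ b)) (evaluate-linear g φ x))

  convolve-scale : ∀ {a b} {X : Set a} {Y : Set b} (I : List (X × Y)) μ ν p q →
                   convolve I (λ x → μ * p x) (λ y → ν * q y) ≈ (μ * ν) * convolve I p q
  convolve-scale I μ ν p q = ≈-trans (∑-cong I λ _ → *-interchange _ _ _ _) (∑-*ˡ (μ * ν) _ I)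

  evaluate-bilinear : ∀ {B : Set ℓ} {a b} {X : Set a} {Y : Set b} (I : List (X × Y)) (_∙_ : B → B → B)
                      (g : B → 𝕂) (p : B → X → 𝕂) (q : B → Y → 𝕂) →
                      (∀ b b′ → g (b ∙ b′) ≈ convolve I (p b) (q b′)) → ∀ x y →
                      evaluate g (bilinear _∙_ x y) ≈ convolve I (λ i → evaluate (λ b → p b i) x) (λ j → evaluate (λ b → q b j) y)
  evaluate-bilinear I _∙_ g p q g≈ = convolve-cartesian I (λ (μ , b) i → μ * p b i) (λ (ν , b) j → ν * q b j) _ _
    λ (μ , b) (ν , b′) → ≈-trans (*-congˡ (g≈ b b′)) (≈-sym (convolve-scale I μ ν (p b) (q b′)))

-- The graded algebra morphism

module Morphism {c k ℓ} (em : ExcludedMiddle ℓ) (K : CommutativeRing c k) (𝒮 : Signature ℓ) where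
  open Forests 𝒮
  open Realization em K 𝒮
  open Summation em K 𝒮
  open Combinations em K 𝒮
  open CommutativeRing K hiding (zero; _-_) renaming (Carrier to 𝕂; refl to ≈-refl; sym to ≈-sym; trans to ≈-trans)
  open import Relation.Binary.Reasoning.Setoid setoid

  module _ (A : Alphabet 𝒮) where
    open Fitting A

    realize : List (Letter A) → ReducedForest → 𝕂
    realize w f = 𝟙[ FitsForest (forest f) w ]

    -- Each coefficient of `r A x` is a linear functional of `x`, which reduces the properties of
    -- `r` to those of `realize w` on basis elements.
    coeff-r : ∀ x w → coeff (r A x) w ≈ evaluate (realize w) x
    coeff-r []            w = ≈-refl
    coeff-r ((μ , f) ∷ x) w =
      +-cong (*-congˡ (𝟙-cong (compatible⇒fits (forest f)) (fits⇒compatible (forest f)))) (coeff-r x w)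

    realize-· : ∀ w f g → realize w (f · g) ≈
                convolve (elements (factorizations w)) (λ u → realize u f) (λ v → realize v g)
    realize-· w f g = ≈-trans (𝟙-cong (fits-++⇒ (forest f) (forest g)) (fits-++⇐ (forest f) (forest g)))
      (≈-sym (convolve-𝟙 (FitsForest (forest f)) (FitsForest (forest g)) (fits*-length (fromList (forest f))) w))

    open Polynomials (Letter A)

    r-cong : ∀ {x y} → x ≈ᴺ y → r A x ≈ᴾ r A y
    r-cong {x} {y} x≈y w = ≈-trans (coeff-r x w) (≈-trans (evaluate-resp (realize w) x y x≈y) (≈-sym (coeff-r y w)))

    r-+ : ∀ x y → r A (x ++ y) ≈ᴾ (r A x +ᴾ r A y)
    r-+ x y w = ≈-trans (coeff-r (x ++ y) w) (≈-trans (∑-++ _ x y) (≈-sym (+-cong (coeff-r x w) (coeff-r y w))))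

    r-neg : ∀ x → r A (map (map₁ (-_)) x) ≈ᴾ (-ᴾ r A x)
    r-neg x w = ≈-trans (coeff-r (map (map₁ (-_)) x) w) (≈-trans (evaluate-neg (realize w) x) (-‿cong (≈-sym (coeff-r x w))))

    r-scale : ∀ μ x → r A (map (map₁ (μ *_)) x) ≈ᴾ (μ •ᴾ r A x)
    r-scale μ x w = ≈-trans (coeff-r (map (map₁ (μ *_)) x) w)
      (≈-trans (evaluate-scale (realize w) μ x) (*-congˡ (≈-sym (coeff-r x w))))

    r-* : ∀ x y → r A (bilinear _·_ x y) ≈ᴾ (r A x *ᴾ r A y)
    r-* x y w = begin
      coeff (r A (bilinear _·_ x y)) w
        ≈⟨ coeff-r (bilinear _·_ x y) w ⟩
      evaluate (realize w) (bilinear _·_ x y)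
        ≈⟨ evaluate-bilinear (elements (factorizations w)) _·_ (realize w) (λ f u → realize u f) (λ g v → realize v g) (realize-· w) x y ⟩
      convolve (elements (factorizations w)) (λ u → evaluate (realize u) x) (λ v → evaluate (realize v) y)
        ≈⟨ convolve-cong (elements (factorizations w)) (coeff-r x) (coeff-r y) ⟨
      coeff (r A x *ᴾ r A y) w ∎

    r-1 : r A (𝐄 ∅) ≈ᴾ 1ᴾ
    r-1 w = ≈-trans (coeff-r (𝐄 ∅) w) (≈-trans (evaluate-basis (realize w) ∅) (empty w))
      where
      empty : ∀ w → realize w ∅ ≈ coeff 1ᴾ w
      empty []      = 𝟙-true refl
      empty (_ ∷ _) = 𝟙-false λ ()

    -- Homogeneity constrains the coefficients of `x`, not its terms, which may have other degrees
    -- and cancel. Like terms are therefore collected first.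
    r-graded : ∀ n x → Homogeneousᴺ n x → Homogeneous n (r A x)
    r-graded n x hom w ≢n with support x
    ... | bs , ubs , ⊆bs = begin
      coeff (r A x) w                                ≈⟨ coeff-r x w ⟩
      evaluate (realize w) x                         ≈⟨ evaluate-coefficient (realize w) ubs x ⊆bs ⟩
      ∑ bs (λ f → coefficient x f * realize w f)     ≈⟨ ∑-zero bs (λ {f} _ → vanishes f) ⟩
      0#                                             ∎
      where
      vanishes : ∀ f → coefficient x f * realize w f ≈ 0#
      vanishes f with deg (forest f) ≟ n
      ... | yes refl = ≈-trans (*-congˡ (𝟙-false λ q → ≢n (fits*-length (fromList (forest f)) q))) (zeroʳ _)
      ... | no deg≢n = ≈-trans (*-congʳ (hom f deg≢n)) (zeroˡ _)

    r-isGradedAlgebraMorphism : IsGradedAlgebraMorphism (r A)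
    r-isGradedAlgebraMorphism = record
      { isLinear = record
        { +ᴹ-isGroupHomomorphism = record
          { isMonoidHomomorphism = record
            { isMagmaHomomorphism = record
              { isRelHomomorphism = record { cong = λ {x} {y} → r-cong {x} {y} } ; homo = r-+ }
            ; ε-homo = λ _ → ≈-refl
            }
          ; ⁻¹-homo = r-neg
          }
        ; *ₗ-homo = r-scale
        }
      ; isRingHomomorphism = record
        { isSemiringHomomorphism = record
          { isNearSemiringHomomorphism = record
            { +-isMonoidHomomorphism = record
              { isMagmaHomomorphism = record
                { isRelHomomorphism = record { cong = λ {x} {y} → r-cong {x} {y} } ; homo = r-+ }
              ; ε-homo = λ _ → ≈-refl
              }
            ; *-homo = r-*
            }
          ; 1#-homo = r-1
          }
        ; -‿homo = r-neg
        }
      ; isGraded = r-graded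
      }

  -- Injectivity for the alphabet of positions

  r-positions-injective : let open Polynomials (Letter (positions 𝒮)) in Injective _≈ᴺ_ _≈ᴾ_ (r (positions 𝒮))
  r-positions-injective {x} {y} rx≈ry f = begin
    coefficient x f                                            ≈⟨ coeff-forestWord x ⟨
    coeff (r (positions 𝒮) x) (forestWord (forest f))          ≈⟨ rx≈ry (forestWord (forest f)) ⟩
    coeff (r (positions 𝒮) y) (forestWord (forest f))          ≈⟨ coeff-forestWord y ⟩
    coefficient y f                                            ∎
    where
    open PathWords 𝒮
    open Fitting (positions 𝒮)

    coeff-forestWord : ∀ x → coeff (r (positions 𝒮) x) (forestWord (forest f)) ≈ coefficient x f
    coeff-forestWord x = ≈-trans (coeff-r (positions 𝒮) x _) (∑-cong x λ (μ , g) → *-congˡ (𝟙-cong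
      (λ q → compatible⇒≡ f g (fits⇒compatible (forest g) q))
      (λ { refl → compatible⇒fits (forest f) (forestWord-compatible (forest f)) })))

  -- Disjoint sums and the coproduct

  module _ (A₁ A₂ : Alphabet 𝒮) where
    open DisjointSum A₁ A₂
    module F₁ = Fitting A₁
    open Decompositions

    ∑-shuffles-[] : ∀ (u : List (Letter A₁)) (v : List (Letter A₂)) →
                    ∑ (elements (shuffles u v)) (λ w → 𝟙[ w ≡ [] ]) ≈ 𝟙[ u ≡ [] ] * 𝟙[ v ≡ [] ]
    ∑-shuffles-[] u v = ≈-trans
      (∑-𝟙 (unique (shuffles u v)) (λ _ _ p q → trans p (sym q))
        (λ { w∈ refl → let eq = sym (sound (shuffles u v) w∈) in cong proj₁ eq , cong proj₂ eq })
        (λ { (refl , refl) → [] , here refl , refl }))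
      𝟙-×

    -- The first letter of a word labels the root, so these separate the words with root in `A₁`
    -- from those with root in `A₂`.
    left right : (List (Letter A₁ ⊎ Letter A₂) → 𝕂) → List (Letter A₁) → List (Letter A₂) → 𝕂
    left g []      v = 0#
    left g (a ∷ u) v = ∑ (elements (shuffles u v)) λ w → g (inj₁ a ∷ w)
    right g u []      = 0#
    right g u (b ∷ v) = ∑ (elements (shuffles u v)) λ w → g (inj₂ b ∷ w)

    -- The assumption on `g []` settles the case of two empty words. The summand `right` comes first
    -- because the decompositions of a node begin with the one whose upper part is a leaf.
    ∑-shuffles-∷ : ∀ g → g [] ≈ 0# → ∀ u v → ∑ (elements (shuffles u v)) g ≈ right g u v + left g u v
    ∑-shuffles-∷ g g[]≈0 []      []      = +-congʳ g[]≈0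
    ∑-shuffles-∷ g g[]≈0 []      (b ∷ v) = ≈-trans (∑-map g _ (elements (shuffles [] v))) (≈-sym (+-identityʳ _))
    ∑-shuffles-∷ g g[]≈0 (a ∷ u) []      = ≈-trans (∑-map g _ (elements (shuffles u []))) (≈-sym (+-identityˡ _))
    ∑-shuffles-∷ g g[]≈0 (a ∷ u) (b ∷ v) = ≈-trans (∑-++ g (map _ (elements (shuffles u (b ∷ v)))) _)
      (≈-trans (+-cong (∑-map g _ (elements (shuffles u (b ∷ v)))) (∑-map g _ (elements (shuffles (a ∷ u) v)))) (+-comm _ _))

    -- An edge never leads from A₂ to A₁, so once the root is in A₂ so is the whole term.

    ∑-shuffles-inj₂ : ∀ (P₁ : Pred (Letter A₁) ℓ) s ts u v →
      right (λ w → 𝟙[ F.Fits [ P₁ , R A₂ ]′ (node s ts) w ]) u v ≈ 𝟙[ u ≡ [] ] * 𝟙[ F₂.FitsForest (node s ts ∷ []) v ]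
    ∑-shuffles-inj₂ P₁ s ts u []      = ≈-sym (≈-trans (*-congˡ (𝟙-false (absurd ∘ F₂.fits-[·]⇒ (node s ts)))) (zeroʳ _))
      where
      absurd : ¬ F₂.Fits (R A₂) (node s ts) []
      absurd ()
    ∑-shuffles-inj₂ P₁ s ts u (b ∷ v) = begin
      ∑ (elements (shuffles u v)) (λ w → 𝟙[ F.Fits [ P₁ , R A₂ ]′ (node s ts) (inj₂ b ∷ w) ])
        -- By `to`, a fitting shuffle can only be `map inj₂ v`.
        ≈⟨ ∑-𝟙 (unique (shuffles u v))
             (λ w∈ w∈′ p p′ → trans (proj₂ (proj₂ (to w∈ p))) (sym (proj₂ (proj₂ (to w∈′ p′)))))
             (λ w∈ p → let u≡[] , q , _ = to w∈ p in u≡[] , F₂.fits-[·]⇐ (node s ts) q)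
             (λ { (refl , q) → let b∈ , q′ = F₂.fits-[·]⇒ (node s ts) q in
                  map inj₂ v , complete (shuffles [] v) (partitionSums-inj₂ v) , b∈ , fits*-inj₂⇐ id ts q′ }) ⟩
      𝟙[ u ≡ [] × F₂.FitsForest (node s ts ∷ []) (b ∷ v) ]
        ≈⟨ 𝟙-× ⟩
      𝟙[ u ≡ [] ] * 𝟙[ F₂.FitsForest (node s ts ∷ []) (b ∷ v) ] ∎
      where
      to : ∀ {w} → w ∈ elements (shuffles u v) → F.Fits [ P₁ , R A₂ ]′ (node s ts) (inj₂ b ∷ w) →
           u ≡ [] × F₂.Fits (R A₂) (node s ts) (b ∷ v) × w ≡ map inj₂ v
      to w∈ (b∈ , q) with fits*-inj₂⇒ (λ ()) id ts q
      ... | v′ , refl , q′ with trans (sym (partitionSums-inj₂ v′)) (sound (shuffles u v) w∈)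
      ...   | refl = refl , (b∈ , q′) , refl

    -- Cutting t along the edges from A₁ to A₂ matches the words fitting t with the decompositions of t.

    mutual
      ∑-shuffles-fits : ∀ t (P₁ : Pred (Letter A₁) ℓ) u v →
        ∑ (elements (shuffles u v)) (λ w → 𝟙[ F.Fits [ P₁ , R A₂ ]′ t w ]) ≈
        ∑ (elements (decompositions t)) λ (t′ , us) → 𝟙[ F₁.Fits P₁ t′ u ] * 𝟙[ F₂.FitsForest (toList us) v ]
      ∑-shuffles-fits leaf P₁ u v = begin
        ∑ (elements (shuffles u v)) (λ w → 𝟙[ w ≡ [] ])             ≈⟨ ∑-shuffles-[] u v ⟩
        𝟙[ u ≡ [] ] * 𝟙[ v ≡ [] ]                                   ≈⟨ *-congˡ (𝟙-cong (F₂.fits-[·]⇐ leaf) (F₂.fits-[·]⇒ leaf)) ⟩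
        𝟙[ u ≡ [] ] * 𝟙[ F₂.FitsForest (leaf ∷ []) v ]              ≈⟨ +-identityʳ _ ⟨
        𝟙[ u ≡ [] ] * 𝟙[ F₂.FitsForest (leaf ∷ []) v ] + 0#         ∎
      ∑-shuffles-fits (node s ts) P₁ u v = begin
        ∑ (elements (shuffles u v)) g                               ≈⟨ ∑-shuffles-∷ g (𝟙-false λ ()) u v ⟩
        -- A root in `A₂` accounts for the decomposition with `t′` a leaf, a root in `A₁` for those
        -- with `t′` a node.
        right g u v + left g u v                                    ≈⟨ +-cong (∑-shuffles-inj₂ P₁ s ts u v) (≈-trans (above u) (≈-sym (∑-map _ (node′ s) (go* ts)))) ⟩
        _                                                           ∎
        where
        g : List (Letter A₁ ⊎ Letter A₂) → 𝕂
        g w = 𝟙[ F.Fits [ P₁ , R A₂ ]′ (node s ts) w ]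

        above : ∀ u → left g u v ≈ ∑ (go* ts) λ (ts′ , us) → 𝟙[ F₁.Fits P₁ (node s ts′) u ] * 𝟙[ F₂.FitsForest (toList us) v ]
        above []      = ≈-sym (∑-zero (go* ts) λ _ → ≈-trans (*-congʳ (𝟙-false λ ())) (zeroˡ _))
        above (a ∷ u) = begin
          ∑ (elements (shuffles u v)) (λ w → 𝟙[ (P₁ a × D A₁ s a) × F.Fits* (λ j → E (A₁ ⧺ A₂) (suc j) (inj₁ a)) ts w ])
            ≈⟨ ∑-cong (elements (shuffles u v)) (λ w → ≈-trans 𝟙-× (*-congˡ (𝟙-cong (F.fits*-mono (λ {_} {x} → edge-inj₁⇒ a x) ts) (F.fits*-mono (λ {_} {x} → edge-inj₁⇐ a x) ts)))) ⟩
          ∑ (elements (shuffles u v)) (λ w → 𝟙[ P₁ a × D A₁ s a ] * 𝟙[ F.Fits* (λ j → [ E A₁ (suc j) a , R A₂ ]′) ts w ])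
            ≈⟨ ∑-*ˡ _ _ (elements (shuffles u v)) ⟩
          𝟙[ P₁ a × D A₁ s a ] * ∑ (elements (shuffles u v)) (λ w → 𝟙[ F.Fits* (λ j → [ E A₁ (suc j) a , R A₂ ]′) ts w ])
            ≈⟨ *-congˡ (∑-shuffles-fits* ts (λ j → E A₁ (suc j) a) u v) ⟩
          𝟙[ P₁ a × D A₁ s a ] * ∑ (go* ts) (λ (ts′ , us) → 𝟙[ F₁.Fits* (λ j → E A₁ (suc j) a) ts′ u ] * 𝟙[ F₂.FitsForest (toList us) v ])
            ≈⟨ ∑-*ˡ _ _ (go* ts) ⟨
          ∑ (go* ts) (λ (ts′ , us) → 𝟙[ P₁ a × D A₁ s a ] * (𝟙[ F₁.Fits* (λ j → E A₁ (suc j) a) ts′ u ] * 𝟙[ F₂.FitsForest (toList us) v ]))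
            ≈⟨ ∑-cong (go* ts) (λ _ → ≈-trans (*-congʳ 𝟙-×) (*-assoc _ _ _)) ⟨
          ∑ (go* ts) (λ (ts′ , us) → 𝟙[ F₁.Fits P₁ (node s ts′) (a ∷ u) ] * 𝟙[ F₂.FitsForest (toList us) v ]) ∎

      ∑-shuffles-fits* : ∀ {n} (ts : Vec Term n) (Q₁ : ℕ → Pred (Letter A₁) ℓ) u v →
        ∑ (elements (shuffles u v)) (λ w → 𝟙[ F.Fits* (λ j → [ Q₁ j , R A₂ ]′) ts w ]) ≈
        ∑ (go* ts) λ (ts′ , us) → 𝟙[ F₁.Fits* Q₁ ts′ u ] * 𝟙[ F₂.FitsForest (toList us) v ]
      ∑-shuffles-fits* []       Q₁ u v = ≈-trans (∑-shuffles-[] u v) (≈-sym (+-identityʳ _))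
      ∑-shuffles-fits* (t ∷ ts) Q₁ u v = begin
        ∑ (elements (shuffles u v)) (λ w → 𝟙[ F.Fits* (λ j → [ Q₁ j , R A₂ ]′) (t ∷ ts) w ])
          ≈⟨ ∑-cong (elements (shuffles u v)) (convolve-𝟙 (F.Fits [ Q₁ 0 , R A₂ ]′ t) (F.Fits* (λ j → [ Q₁ (suc j) , R A₂ ]′) ts) (F.fits-length t)) ⟨
        ∑ (elements (shuffles u v)) (λ w → convolve (elements (factorizations w))
          (λ w₁ → 𝟙[ F.Fits [ Q₁ 0 , R A₂ ]′ t w₁ ]) (λ w₂ → 𝟙[ F.Fits* (λ j → [ Q₁ (suc j) , R A₂ ]′) ts w₂ ]))
          ≈⟨ ∑-shuffles-convolve _ _ u v ⟩
        convolve (elements (splits u v))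
          (λ (u₁ , v₁) → ∑ (elements (shuffles u₁ v₁)) (λ w → 𝟙[ F.Fits [ Q₁ 0 , R A₂ ]′ t w ]))
          (λ (u₂ , v₂) → ∑ (elements (shuffles u₂ v₂)) (λ w → 𝟙[ F.Fits* (λ j → [ Q₁ (suc j) , R A₂ ]′) ts w ]))
          ≈⟨ convolve-cong (elements (splits u v))
               (λ (u₁ , v₁) → ∑-shuffles-fits t (Q₁ 0) u₁ v₁) (λ (u₂ , v₂) → ∑-shuffles-fits* ts (Q₁ ∘ suc) u₂ v₂) ⟩
        convolve (elements (splits u v))
          (λ (u₁ , v₁) → ∑ (go t) λ (t′ , us) → 𝟙[ F₁.Fits (Q₁ 0) t′ u₁ ] * 𝟙[ F₂.FitsForest (toList us) v₁ ])
          (λ (u₂ , v₂) → ∑ (go* ts) λ (ts′ , us) → 𝟙[ F₁.Fits* (Q₁ ∘ suc) ts′ u₂ ] * 𝟙[ F₂.FitsForest (toList us) v₂ ])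
          -- A decomposition of `t ∷ ts` pairs one of `t` with one of `ts` and concatenates their
          -- lower forests, so its summand is a product of tensors.
          ≈⟨ convolve-cartesian (elements (splits u v))
               (λ (t′ , us) (u₁ , v₁) → 𝟙[ F₁.Fits (Q₁ 0) t′ u₁ ] * 𝟙[ F₂.FitsForest (toList us) v₁ ])
               (λ (ts′ , us) (u₂ , v₂) → 𝟙[ F₁.Fits* (Q₁ ∘ suc) ts′ u₂ ] * 𝟙[ F₂.FitsForest (toList us) v₂ ])
               _ cons (λ (t′ , us) (ts′ , us′) → ≈-sym (≈-trans (convolve-⊗ u v _ _ _ _) (*-cong
                 (convolve-𝟙 (F₁.Fits (Q₁ 0) t′) (F₁.Fits* (Q₁ ∘ suc) ts′) (F₁.fits-length t′) u)
                 (≈-trans (convolve-𝟙 (F₂.FitsForest (toList us)) (F₂.FitsForest (toList us′)) (F₂.fits*-length (fromList (toList us))) v)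
                   (grafted us us′)))))
               (go t) (go* ts) ⟨
        ∑ (go* (t ∷ ts)) (λ (ts′ , us) → 𝟙[ F₁.Fits* Q₁ ts′ u ] * 𝟙[ F₂.FitsForest (toList us) v ]) ∎
        where
        grafted : ∀ {m n} (us : Vec Term m) (us′ : Vec Term n) →
                  𝟙[ Concat (F₂.FitsForest (toList us)) (F₂.FitsForest (toList us′)) v ] ≈ 𝟙[ F₂.FitsForest (toList (us Vec.++ us′)) v ]
        grafted us us′ rewrite toList-++ us us′ =
          𝟙-cong (F₂.fits-++⇐ (toList us) (toList us′)) (F₂.fits-++⇒ (toList us) (toList us′))

    realize⊗ : List (Letter A₁) → List (Letter A₂) → ReducedForest × ReducedForest → 𝕂
    realize⊗ u v (f , g) = realize A₁ u f * realize A₂ v g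

    -- The words fitting a forest do not change under `rd`, so the reductions in the coproduct drop
    -- out.
    evaluate-Δ-term : ∀ t u v → evaluate (realize⊗ u v) (Δ-term t) ≈
                      ∑ (elements (decompositions t)) λ (t′ , us) → 𝟙[ F₁.Fits (R A₁) t′ u ] * 𝟙[ F₂.FitsForest (toList us) v ]
    evaluate-Δ-term t u v = ≈-trans (∑-map _ _ (elements (decompositions t)))
      (∑-cong (elements (decompositions t)) λ (t′ , us) → ≈-trans (*-identityˡ _) (*-cong
        (𝟙-cong (F₁.fits-[·]⇒ t′ ∘ F₁.fits-rd⇒ (t′ ∷ [])) (F₁.fits-rd⇐ (t′ ∷ []) ∘ F₁.fits-[·]⇐ t′))
        (𝟙-cong (F₂.fits-rd⇒ (toList us)) (F₂.fits-rd⇐ (toList us)))))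

    realize⊗-· : ∀ u v f g f′ g′ → realize⊗ u v (f · f′ , g · g′) ≈
                 convolve (elements (splits u v)) (λ (u₁ , v₁) → realize⊗ u₁ v₁ (f , g)) (λ (u₂ , v₂) → realize⊗ u₂ v₂ (f′ , g′))
    realize⊗-· u v f g f′ g′ = ≈-trans (*-cong (realize-· A₁ u f f′) (realize-· A₂ v g g′)) (≈-sym (convolve-⊗ u v _ _ _ _))

    ∑-shuffles-forest : ∀ f u v → ∑ (elements (shuffles u v)) (λ w → 𝟙[ F.FitsForest f w ]) ≈ evaluate (realize⊗ u v) (Δ-forest f)
    ∑-shuffles-forest []      u v = ≈-trans (∑-shuffles-[] u v) (≈-sym (evaluate-basis (realize⊗ u v) (∅ , ∅)))
    ∑-shuffles-forest (t ∷ f) u v = begin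
      ∑ (elements (shuffles u v)) (λ w → 𝟙[ F.FitsForest (t ∷ f) w ])
        ≈⟨ ∑-cong (elements (shuffles u v)) (convolve-𝟙 (F.Fits (R (A₁ ⧺ A₂)) t) (F.FitsForest f) (F.fits-length t)) ⟨
      ∑ (elements (shuffles u v)) (λ w → convolve (elements (factorizations w))
        (λ w₁ → 𝟙[ F.Fits (R (A₁ ⧺ A₂)) t w₁ ]) (λ w₂ → 𝟙[ F.FitsForest f w₂ ]))
        ≈⟨ ∑-shuffles-convolve _ _ u v ⟩
      convolve (elements (splits u v))
        (λ (u₁ , v₁) → ∑ (elements (shuffles u₁ v₁)) (λ w → 𝟙[ F.Fits (R (A₁ ⧺ A₂)) t w ]))
        (λ (u₂ , v₂) → ∑ (elements (shuffles u₂ v₂)) (λ w → 𝟙[ F.FitsForest f w ]))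
        ≈⟨ convolve-cong (elements (splits u v))
             -- By definition `R (A₁ ⧺ A₂)` is `[ R A₁ , R A₂ ]′`, so the result for one term
             -- applies with `R A₁` as `P₁`.
             (λ (u₁ , v₁) → ≈-trans (∑-shuffles-fits t (R A₁) u₁ v₁) (≈-sym (evaluate-Δ-term t u₁ v₁)))
             (λ (u₂ , v₂) → ∑-shuffles-forest f u₂ v₂) ⟩
      convolve (elements (splits u v))
        (λ (u₁ , v₁) → evaluate (realize⊗ u₁ v₁) (Δ-term t)) (λ (u₂ , v₂) → evaluate (realize⊗ u₂ v₂) (Δ-forest f))
        ≈⟨ evaluate-bilinear (elements (splits u v)) _ (realize⊗ u v)
             (λ fg (u₁ , v₁) → realize⊗ u₁ v₁ fg) (λ fg (u₂ , v₂) → realize⊗ u₂ v₂ fg)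
             (λ (f , g) (f′ , g′) → realize⊗-· u v f g f′ g′) (Δ-term t) (Δ-forest f) ⟨
      evaluate (realize⊗ u v) (Δ-term t *⊗ Δ-forest f) ∎

    ⊗₁-evaluate : ∀ z u v → (r A₁ ⊗₁ r A₂) z u v ≈ evaluate (realize⊗ u v) z
    ⊗₁-evaluate []                  u v = ≈-refl
    ⊗₁-evaluate ((μ , (f , g)) ∷ z) u v = +-cong (*-congˡ (*-cong
      (≈-trans (coeff-r A₁ (𝐄 f) u) (evaluate-basis (realize A₁ u) f))
      (≈-trans (coeff-r A₂ (𝐄 g) v) (evaluate-basis (realize A₂ v) g)))) (⊗₁-evaluate z u v)

    θ-r : ∀ x → θ A₁ A₂ (r (A₁ ⧺ A₂) x) ≈⊗ (r A₁ ⊗₁ r A₂) (Δ x)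
    θ-r x u v = begin
      ∑ (elements (shuffles u v)) (coeff (r (A₁ ⧺ A₂) x))
        ≈⟨ ∑-cong (elements (shuffles u v)) (coeff-r (A₁ ⧺ A₂) x) ⟩
      ∑ (elements (shuffles u v)) (λ w → ∑ x λ (μ , f) → μ * 𝟙[ F.FitsForest (forest f) w ])
        ≈⟨ ∑-comm (λ w (μ , f) → μ * 𝟙[ F.FitsForest (forest f) w ]) (elements (shuffles u v)) x ⟩
      ∑ x (λ (μ , f) → ∑ (elements (shuffles u v)) λ w → μ * 𝟙[ F.FitsForest (forest f) w ])
        ≈⟨ ∑-cong x (λ (μ , f) → ≈-trans (∑-*ˡ μ _ (elements (shuffles u v))) (*-congˡ (∑-shuffles-forest (forest f) u v))) ⟩
      evaluate (evaluate (realize⊗ u v) ∘ Δ-forest ∘ forest) x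
        ≈⟨ evaluate-linear (realize⊗ u v) (Δ-forest ∘ forest) x ⟨
      evaluate (realize⊗ u v) (Δ x)
        ≈⟨ ⊗₁-evaluate (Δ x) u v ⟨
      (r A₁ ⊗₁ r A₂) (Δ x) u v ∎

-- Associativity of the disjoint sum

⧺-assoc : ∀ {ℓ} {𝒮 : Signature ℓ} (A₁ A₂ A₃ : Alphabet 𝒮) → IsIsomorphism ((A₁ ⧺ A₂) ⧺ A₃) (A₁ ⧺ (A₂ ⧺ A₃)) assocʳ
⧺-assoc A₁ A₂ A₃ = record
  { bijective = (λ {x} {y} eq → trans (sym (assocˡ-assocʳ x)) (trans (cong assocˡ eq) (assocˡ-assocʳ y)))
              , λ y → assocˡ y , λ { refl → assocʳ-assocˡ y }
  ; R-⇔ = λ { (inj₁ (inj₁ _)) → ⇔-refl ; (inj₁ (inj₂ _)) → ⇔-refl ; (inj₂ _) → ⇔-refl }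
  ; D-⇔ = λ { s (inj₁ (inj₁ _)) → ⇔-refl ; s (inj₁ (inj₂ _)) → ⇔-refl ; s (inj₂ _) → ⇔-refl }
  -- In either nesting, an edge to a later summand is the root condition on its target and an edge
  -- to an earlier one is impossible.
  ; E-⇔ = λ { j (inj₁ (inj₁ _)) (inj₁ (inj₁ _)) → ⇔-refl
            ; j (inj₁ (inj₁ _)) (inj₁ (inj₂ _)) → ⇔-refl
            ; j (inj₁ (inj₁ _)) (inj₂ _)        → ⇔-refl
            ; j (inj₁ (inj₂ _)) (inj₁ (inj₁ _)) → ⇔-refl
            ; j (inj₁ (inj₂ _)) (inj₁ (inj₂ _)) → ⇔-refl
            ; j (inj₁ (inj₂ _)) (inj₂ _)        → ⇔-refl
            ; j (inj₂ _)        (inj₁ (inj₁ _)) → ⇔-refl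
            ; j (inj₂ _)        (inj₁ (inj₂ _)) → ⇔-refl
            ; j (inj₂ _)        (inj₂ _)        → ⇔-refl }
  }
  where
  ⇔-refl : ∀ {p} {P : Set p} → P ⇔ P
  ⇔-refl = mk⇔ id id

  assocˡ-assocʳ : ∀ (x : Letter ((A₁ ⧺ A₂) ⧺ A₃)) → assocˡ (assocʳ x) ≡ x
  assocˡ-assocʳ (inj₁ (inj₁ _)) = refl
  assocˡ-assocʳ (inj₁ (inj₂ _)) = refl
  assocˡ-assocʳ (inj₂ _)        = refl

  assocʳ-assocˡ : ∀ (x : Letter (A₁ ⧺ (A₂ ⧺ A₃))) → assocʳ (assocˡ x) ≡ x
  assocʳ-assocˡ (inj₁ _)        = refl
  assocʳ-assocˡ (inj₂ (inj₁ _)) = refl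
  assocʳ-assocˡ (inj₂ (inj₂ _)) = refl

theorem4p8 : {c k ℓ : Level} (em : ExcludedMiddle ℓ)
    (K : CommutativeRing c k) → IsField K → CharacteristicZero K →
    (𝒮 : Signature ℓ) →
    let open Realization em K 𝒮
        open Polynomials (Alphabet.Letter (positions 𝒮)) using (_≈ᴾ_)
    in
      ((A₁ A₂ A₃ : Alphabet 𝒮) → IsIsomorphism ((A₁ ⧺ A₂) ⧺ A₃) (A₁ ⧺ (A₂ ⧺ A₃)) assocʳ)
    × ((A : Alphabet 𝒮) → IsGradedAlgebraMorphism (r A))
    × ((A₁ A₂ : Alphabet 𝒮) (x : N) → θ A₁ A₂ (r (A₁ ⧺ A₂) x) ≈⊗ (r A₁ ⊗₁ r A₂) (Δ x))
    × Injective _≈ᴺ_ _≈ᴾ_ (r (positions 𝒮))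
theorem4p8 em K _ _ 𝒮 = ⧺-assoc , r-isGradedAlgebraMorphism , θ-r , λ {x} {y} → r-positions-injective {x} {y}
  where open Morphism em K 𝒮
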